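{- For every constant integer $q\ge4$, any CONGEST algorithm (possibly randomized, succeeding with probability at least $2/3$) that detects whether a directed unweighted $n$-vertex graph contains a directed cycle of length exactly $q$ requires $\Omega\!\left(\frac{n}{\log n}\right)$ rounds in the worst case.
   Context: CONGEST model: the communication network is the graph $G=(V,E)$, $n=|V|$; each node has a unique identifier in $\{0,\dots,n-1\}$, knows its own and its neighbours' identifiers and its incident edges (with their directions); computation proceeds in synchronous rounds in which each node may send a message of $O(\log n)$ bits to each neighbour; local computation is free; communication links are bidirectional even when $G$ is directed. $q$-cycle detection: some vertex must report a cycle if $G$ contains a simple directed cycle of length $q$, and no vertex may report one otherwise. -}

module Defs where

open import Data.Bool.Base using (Bool; true; false; _∨_; if_then_else_)
import Data.Bool.Properties as Bool
open import Data.Fin.Base using (Fin; toℕ; finToFun)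
open import Data.Fin.Properties using (any?)
open import Data.Fin.Subset using (Subset)
open import Data.List.Base using (length; filter; allFin)
open import Data.Maybe using (Maybe; just; nothing; Is-just)
open import Data.Maybe.Properties using (≡-dec)
open import Data.Nat.Base using (ℕ; zero; suc; _*_; _^_; _≤_; NonZero)
open import Data.Nat.DivMod using (_mod_)
open import Data.Nat.Logarithm using (⌈log₂_⌉)
open import Data.Product.Base using (∃; ∃-syntax; _×_)
open import Data.Vec.Base using (Vec; tabulate)
open import Data.Vec.Bounded.Base using (Vec≤)
open import Function.Definitions using (Injective)
open import Level using (0ℓ)
open import Relation.Binary.PropositionalEquality.Core using (_≡_)
open import Relation.Nullary.Decidable.Core using (¬?)
open import Relation.Nullary.Negation.Core using (¬_)
open import Relation.Unary using (Pred; Decidable)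

------------------------------------------------------------------------
-- Asymptotics

O[log-n] : (ℕ → ℕ) → Set
O[log-n] f = ∃[ c ] ∃[ N ] ∀ n → N ≤ n → f n ≤ c * ⌈log₂ n ⌉

-- f n ≥ (1/c) · n / log n with the denominators cleared; the inequality
-- itself rules out c = 0 (take any positive n ≥ N).
Ω[n/log-n] : (ℕ → ℕ) → Set
Ω[n/log-n] f = ∃[ c ] ∃[ N ] ∀ n → N ≤ n → n ≤ c * (f n * ⌈log₂ n ⌉)

------------------------------------------------------------------------
-- Directed graphs

-- Antiparallel edges are allowed, loops are not.
record Digraph (n : ℕ) : Set where
  field
    edge     : Fin n → Fin n → Bool
    loopless : ∀ v → edge v v ≡ false

  -- Communication links ignore the direction of the edges.
  linked : Fin n → Fin n → Bool
  linked u v = edge u v ∨ edge v u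

cyclicSuc : ∀ {q} → Fin q → Fin q
cyclicSuc {suc k} i = suc (toℕ i) mod suc k

HasCycle : ∀ {n} → ℕ → Digraph n → Set
HasCycle {n} q G =
  ∃[ c ] Injective {A = Fin q} {B = Fin n} _≡_ _≡_ c
       × (∀ i → edge (c i) (c (cyclicSuc i)) ≡ true)
  where open Digraph G

------------------------------------------------------------------------
-- The CONGEST model

-- The vertices of an n-vertex network are their identifiers.
record LocalView (n : ℕ) : Set where
  constructor localView
  field
    self                      : Fin n
    outNeighbours inNeighbours : Subset n

viewAt : ∀ {n} → Digraph n → Fin n → LocalView n
viewAt G v = localView v (tabulate (λ u → edge v u)) (tabulate (λ u → edge u v))
  where open Digraph G

-- At most b bits.
Message : ℕ → Set
Message b = Vec≤ Bool b

-- An algorithm for n-vertex networks with b-bit messages.  Each node holds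
-- an independent private seed, uniform on Fin seeds.  A node is running as
-- long as its output is `nothing`; it stops with `just true` if it reports a
-- cycle and with `just false` if it does not.
record Protocol (n b : ℕ) : Set₁ where
  field
    State          : Set
    seeds          : ℕ
    {{seeds≢0}}    : NonZero seeds
    init           : LocalView n → Fin seeds → State
    send           : State → (recipient : Fin n) → Maybe (Message b)
    receive        : State → (inbox : Vec (Maybe (Message b)) n) → State
    output         : State → Maybe Bool

module Execution {n b : ℕ} (P : Protocol n b) (G : Digraph n) where
  open Protocol P
  open Digraph G

  -- Stopped nodes neither send nor change state; messages travel only
  -- along links.

  emit : State → Fin n → Maybe (Message b)
  emit s v with output s
  ... | nothing = send s v
  ... | just _  = nothing

  absorb : State → Vec (Maybe (Message b)) n → State
  absorb s inbox with output s
  ... | nothing = receive s inbox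
  ... | just _  = s

  round : (Fin n → State) → (Fin n → State)
  round σ v =
    absorb (σ v) (tabulate λ u → if linked u v then emit (σ u) v else nothing)

  -- The joint seed of all nodes: finToFun is a bijection between
  -- Fin (seeds ^ n) and Fin n → Fin seeds.
  Seed : Set
  Seed = Fin (seeds ^ n)

  stateAfter : ℕ → Seed → Fin n → State
  stateAfter zero    ω = λ v → init (viewAt G v) (finToFun ω v)
  stateAfter (suc t) ω = round (stateAfter t ω)

  HaltedAfter : ℕ → Pred Seed 0ℓ
  HaltedAfter t ω = ∀ v → Is-just (output (stateAfter t ω v))

  ReportedAfter : ℕ → Pred Seed 0ℓ
  ReportedAfter t ω = ∃ λ v → output (stateAfter t ω v) ≡ just true

  reportedAfter? : ∀ t → Decidable (ReportedAfter t)
  reportedAfter? t ω =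
    any? λ v → ≡-dec Bool._≟_ (output (stateAfter t ω v)) (just true)

record Algorithm : Set₁ where
  field
    bandwidth     : ℕ → ℕ
    bandwidth-log : O[log-n] bandwidth
    protocol      : ∀ n → Protocol n (bandwidth n)

-- For the uniform distribution on Fin N.
Probability≥⅔ : ∀ {N} {E : Pred (Fin N) 0ℓ} → Decidable E → Set
Probability≥⅔ {N} E? = 2 * N ≤ 3 * length (filter E? (allFin N))

-- T n bounds the number of rounds over all n-vertex graphs and all seeds.
RunsWithin : (ℕ → ℕ) → Algorithm → Set
RunsWithin T A = ∀ n (G : Digraph n) →
  let open Execution (Algorithm.protocol A n) G in
  ∀ ω → HaltedAfter (T n) ω

-- The verdict is read after T n rounds; under RunsWithin T A it is final.
DetectsCycles : ℕ → (ℕ → ℕ) → Algorithm → Set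
DetectsCycles q T A = ∀ n (G : Digraph n) →
  let open Execution (Algorithm.protocol A n) G in
    (HasCycle q G   → Probability≥⅔ (reportedAfter? (T n)))
  × (¬ HasCycle q G → Probability≥⅔ (λ ω → ¬? (reportedAfter? (T n) ω)))

{-# OPTIONS --safe #-}

-- A q-cycle of the layered graph built from x, y ⊆ [k²] exists iff x and y
-- meet.  The edges depending on x and those depending on y are separated by
-- 2k links, so T rounds with b-bit messages write the probability of not
-- reporting a cycle as a sum of 2^O(k b T) products f x · g y; seeds being
-- private is what makes the summands products.
--
-- The number of summands is bounded by a form of Razborov's corruption
-- argument.  Draw z uniformly, then x ⊆ z and y ⊆ ¬ z uniformly, so that x and
-- y are disjoint, and independent given z.  If f has density at least 2^-j on
-- the subsets of z, then all but O(j) coordinates are nearly unbiased under f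
-- (a Chernoff bound), and likewise for g; adding such a coordinate i to both x
-- and y barely changes the mass.  Hence a product that is not exponentially
-- small weighs intersecting pairs almost as much as disjoint ones, whereas
-- the whole sum is at least 2/3 on the latter and at most 1/3 on the former:
-- there must be 2^Ω(k²) summands.
module Submission where

open import Data.Bool.Base using (Bool; true; false; _∧_; _∨_; not; if_then_else_)
import Data.Bool.Properties as Bool
open import Data.Empty using (⊥-elim)
open import Data.Fin.Base using (Fin; zero; suc; toℕ; fromℕ; combine; remQuot; splitAt; finToFun; _↑ˡ_; _↑ʳ_)
import Data.Fin.Properties as Fin
open import Data.List.Base as List
  using (List; []; _∷_; _++_; map; allFin; length; filter; cartesianProductWith; cartesianProduct)
import Data.List.Properties as List
open import Data.Maybe.Base as Maybe using (Maybe; just; nothing)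
import Data.Maybe.Properties as Maybe
open import Data.Nat.Base
open import Data.Nat.DivMod
open import Data.Nat.ListAction using (sum)
open import Data.Nat.ListAction.Properties using (sum-++)
open import Data.Nat.Logarithm using (⌈log₂_⌉; ⌈log₂⌉-mono-≤)
open import Data.Nat.Properties
open import Algebra.Properties.CommutativeSemigroup +-commutativeSemigroup
  using () renaming (interchange to +-interchange)
open import Algebra.Properties.CommutativeSemigroup *-commutativeSemigroup
  using () renaming (interchange to *-interchange; x∙yz≈y∙xz to *-exchange)
open import Data.Nat.Tactic.RingSolver using (solve-∀)
open import Data.Product.Base using (_×_; _,_; proj₁; proj₂; ∃-syntax; swap)
open import Data.Sum.Base using (_⊎_; inj₁; inj₂; [_,_]′)
open import Data.Vec.Base as Vec using (Vec; []; _∷_; lookup; tabulate; zipWith; _[_]≔_)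
import Data.Vec.Properties as Vec
open import Data.Vec.Bounded.Base using () renaming (_,_ to bounded)
open import Function.Base using (_∘_; id; it)
open import Function.Bundles using (mk⇔)
open import Level using (0ℓ)
open import Relation.Binary.Definitions using (DecidableEquality)
open import Relation.Binary.PropositionalEquality
open import Relation.Nullary.Decidable
  using (Dec; does; yes; no; ¬?; _×-dec_; does-⇔; dec-true; dec-false)
open import Relation.Nullary.Negation using (¬_)
open import Relation.Unary using (Pred; Decidable)
open import Defs

-- The count behind the bound: k² bits are planted on q · k vertices, but only 2k links of about b
-- bits a round join the two halves, so T is at least of order k / b. This is where `4 ≤ q` and the
-- directions enter. The arcs encoding x and those encoding y occupy two layers each; with at least
-- four layers the two blocks can be joined by perfect matchings on both sides, and only these are
-- cut. The dense blocks contain many undirected cycles, but a directed one must pass through the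
-- layers in cyclic order.
--
-- Nothing is ever divided: `f` and `g` count seed vectors out of W = seeds ^ n, so an entry is
-- measured against W², and a sum over z, x and y against 8^N · W², which is `Z`.
--
-- For each coordinate the corruption step compares twice the disjoint mass with c times the
-- intersecting mass. Success probability 2/3 sets 2 · 2/3 against c · 1/3, so c has to stay below
-- 4. The value used is 3, and the threshold 1/8 that makes a coordinate count as biased is tuned to
-- it; half of the remaining gap then pays for the biased coordinates and the other half for the
-- rectangles of small mass.

private variable
  A₁ A₂ A₃ : Set
  N : ℕ

-- Finite sums

∑ : List A₁ → (A₁ → ℕ) → ℕ
∑ xs φ = sum (map φ xs)

syntax ∑ xs (λ x → e) = ∑[ x ∈ xs ] e

∑-cong : ∀ (xs : List A₁) {φ ψ : A₁ → ℕ} → (∀ x → φ x ≡ ψ x) → ∑ xs φ ≡ ∑ xs ψ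
∑-cong xs φ≗ψ = cong sum (List.map-cong φ≗ψ xs)

∑-mono : ∀ (xs : List A₁) {φ ψ : A₁ → ℕ} → (∀ x → φ x ≤ ψ x) → ∑ xs φ ≤ ∑ xs ψ
∑-mono []       φ≤ψ = z≤n
∑-mono (x ∷ xs) φ≤ψ = +-mono-≤ (φ≤ψ x) (∑-mono xs φ≤ψ)

∑-+ : ∀ (xs : List A₁) (φ ψ : A₁ → ℕ) → (∑[ x ∈ xs ] (φ x + ψ x)) ≡ ∑ xs φ + ∑ xs ψ
∑-+ []       φ ψ = refl
∑-+ (x ∷ xs) φ ψ = trans (cong (φ x + ψ x +_) (∑-+ xs φ ψ))
  (+-interchange (φ x) (ψ x) (∑ xs φ) (∑ xs ψ))

∑-*ˡ : ∀ (xs : List A₁) k (φ : A₁ → ℕ) → (∑[ x ∈ xs ] (k * φ x)) ≡ k * ∑ xs φ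
∑-*ˡ []       k φ = sym (*-zeroʳ k)
∑-*ˡ (x ∷ xs) k φ = trans (cong (k * φ x +_) (∑-*ˡ xs k φ)) (sym (*-distribˡ-+ k (φ x) _))

∑-*ʳ : ∀ (xs : List A₁) k (φ : A₁ → ℕ) → (∑[ x ∈ xs ] (φ x * k)) ≡ ∑ xs φ * k
∑-*ʳ xs k φ = trans (∑-cong xs (λ x → *-comm (φ x) k)) (trans (∑-*ˡ xs k φ) (*-comm k _))

∑-const : ∀ (xs : List A₁) k → (∑[ _ ∈ xs ] k) ≡ length xs * k
∑-const []       k = refl
∑-const (x ∷ xs) k = cong (k +_) (∑-const xs k)

∑-zero : ∀ (xs : List A₁) → (∑[ _ ∈ xs ] 0) ≡ 0
∑-zero xs = trans (∑-const xs 0) (*-zeroʳ (length xs))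

∑-swap : ∀ (xs : List A₁) (ys : List A₂) (φ : A₁ → A₂ → ℕ) →
         (∑[ x ∈ xs ] ∑[ y ∈ ys ] φ x y) ≡ (∑[ y ∈ ys ] ∑[ x ∈ xs ] φ x y)
∑-swap []       ys φ = sym (∑-zero ys)
∑-swap (x ∷ xs) ys φ = trans (cong (∑ ys (φ x) +_) (∑-swap xs ys φ))
  (sym (∑-+ ys (φ x) (λ y → ∑ xs (λ x → φ x y))))

∑-∑-* : ∀ (xs : List A₁) (ys : List A₂) φ ψ →
        (∑[ x ∈ xs ] ∑[ y ∈ ys ] (φ x * ψ y)) ≡ ∑ xs φ * ∑ ys ψ
∑-∑-* xs ys φ ψ = trans (∑-cong xs (λ x → ∑-*ˡ ys (φ x) ψ)) (∑-*ʳ xs (∑ ys ψ) φ)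

∑-++ : ∀ (xs ys : List A₁) φ → ∑ (xs ++ ys) φ ≡ ∑ xs φ + ∑ ys φ
∑-++ xs ys φ = trans (cong sum (List.map-++ φ xs ys)) (sum-++ (map φ xs) (map φ ys))

∑-map : ∀ (f : A₁ → A₂) (xs : List A₁) φ → ∑ (map f xs) φ ≡ ∑ xs (φ ∘ f)
∑-map f xs φ = cong sum (sym (List.map-∘ xs))

∑-cartesian : ∀ (f : A₁ → A₂ → A₃) xs ys φ →
  ∑ (cartesianProductWith f xs ys) φ ≡ (∑[ x ∈ xs ] ∑[ y ∈ ys ] φ (f x y))
∑-cartesian f []       ys φ = refl
∑-cartesian f (x ∷ xs) ys φ = trans (∑-++ (map (f x) ys) _ φ)
  (cong₂ _+_ (∑-map (f x) ys φ) (∑-cartesian f xs ys φ))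

∑-allFin-suc : ∀ n (φ : Fin (suc n) → ℕ) → ∑ (allFin (suc n)) φ ≡ φ zero + ∑ (allFin n) (φ ∘ suc)
∑-allFin-suc n φ = cong (φ zero +_)
  (cong sum (trans (List.map-tabulate suc φ) (sym (List.map-tabulate id (φ ∘ suc)))))

∑-allFin-+ : ∀ m n (φ : Fin (m + n) → ℕ) →
  ∑ (allFin (m + n)) φ ≡ ∑ (allFin m) (φ ∘ (_↑ˡ n)) + ∑ (allFin n) (φ ∘ (m ↑ʳ_))
∑-allFin-+ zero    n φ = refl
∑-allFin-+ (suc m) n φ = begin
  ∑ (allFin (suc m + n)) φ                                                        ≡⟨ ∑-allFin-suc (m + n) φ ⟩
  φ zero + ∑ (allFin (m + n)) (φ ∘ suc)                                           ≡⟨ cong (φ zero +_) (∑-allFin-+ m n (φ ∘ suc)) ⟩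
  φ zero + (∑ (allFin m) (φ ∘ suc ∘ (_↑ˡ n)) + ∑ (allFin n) (φ ∘ (suc m ↑ʳ_)))     ≡⟨ +-assoc (φ zero) _ _ ⟨
  φ zero + ∑ (allFin m) (φ ∘ suc ∘ (_↑ˡ n)) + ∑ (allFin n) (φ ∘ (suc m ↑ʳ_))
    ≡⟨ cong (_+ ∑ (allFin n) (φ ∘ (suc m ↑ʳ_))) (∑-allFin-suc m (φ ∘ (_↑ˡ n))) ⟨
  ∑ (allFin (suc m)) (φ ∘ (_↑ˡ n)) + ∑ (allFin n) (φ ∘ (suc m ↑ʳ_))               ∎
  where open ≡-Reasoning

∑-allFin-* : ∀ m n (φ : Fin (m * n) → ℕ) →
  ∑ (allFin (m * n)) φ ≡ (∑[ i ∈ allFin m ] ∑[ j ∈ allFin n ] φ (combine i j))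
∑-allFin-* zero    n φ = refl
∑-allFin-* (suc m) n φ = begin
  ∑ (allFin (n + m * n)) φ
    ≡⟨ ∑-allFin-+ n (m * n) φ ⟩
  ∑ (allFin n) (φ ∘ (_↑ˡ (m * n))) + ∑ (allFin (m * n)) (φ ∘ (n ↑ʳ_))
    ≡⟨ cong (∑ (allFin n) (φ ∘ (_↑ˡ (m * n))) +_) (∑-allFin-* m n (φ ∘ (n ↑ʳ_))) ⟩
  ∑ (allFin n) (φ ∘ (_↑ˡ (m * n))) + (∑[ i ∈ allFin m ] ∑[ j ∈ allFin n ] φ (combine (suc i) j))
    ≡⟨ ∑-allFin-suc m (λ i → ∑[ j ∈ allFin n ] φ (combine i j)) ⟨
  (∑[ i ∈ allFin (suc m) ] ∑[ j ∈ allFin n ] φ (combine i j)) ∎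
  where open ≡-Reasoning

𝟙 : Bool → ℕ
𝟙 b = if b then 1 else 0

𝟙≤1 : ∀ b → 𝟙 b ≤ 1
𝟙≤1 false = z≤n
𝟙≤1 true  = ≤-refl

𝟙-∧ : ∀ a b → 𝟙 (a ∧ b) ≡ 𝟙 a * 𝟙 b
𝟙-∧ false b = refl
𝟙-∧ true  b = sym (*-identityˡ (𝟙 b))

length-filter-∑ : ∀ {P : Pred A₁ 0ℓ} (P? : Decidable P) xs →
                  length (filter P? xs) ≡ (∑[ x ∈ xs ] 𝟙 (does (P? x)))
length-filter-∑ P? []       = refl
length-filter-∑ P? (x ∷ xs) with does (P? x)
... | false = length-filter-∑ P? xs
... | true  = cong suc (length-filter-∑ P? xs)

words : List A₁ → ∀ n → List (Vec A₁ n)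
words xs zero    = [] ∷ []
words xs (suc n) = cartesianProductWith _∷_ xs (words xs n)

∑-words-suc : ∀ (xs : List A₁) n φ →
  ∑ (words xs (suc n)) φ ≡ (∑[ a ∈ xs ] ∑[ v ∈ words xs n ] φ (a ∷ v))
∑-words-suc xs n φ = ∑-cartesian _∷_ xs (words xs n) φ

length-∑ : ∀ (xs : List A₁) → (∑[ _ ∈ xs ] 1) ≡ length xs
length-∑ xs = trans (∑-const xs 1) (*-identityʳ _)

length-cartesian : ∀ (f : A₁ → A₂ → A₃) xs ys →
  length (cartesianProductWith f xs ys) ≡ length xs * length ys
length-cartesian f xs ys = begin
  length (cartesianProductWith f xs ys)        ≡⟨ length-∑ (cartesianProductWith f xs ys) ⟨
  (∑[ _ ∈ cartesianProductWith f xs ys ] 1)    ≡⟨ ∑-cartesian f xs ys (λ _ → 1) ⟩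
  (∑[ _ ∈ xs ] ∑[ _ ∈ ys ] 1)                  ≡⟨ ∑-const xs _ ⟩
  length xs * (∑[ _ ∈ ys ] 1)                  ≡⟨ cong (length xs *_) (length-∑ ys) ⟩
  length xs * length ys                        ∎
  where open ≡-Reasoning

length-words : ∀ (xs : List A₁) n → length (words xs n) ≡ length xs ^ n
length-words xs zero    = refl
length-words xs (suc n) = trans (length-cartesian _∷_ xs (words xs n)) (cong (length xs *_) (length-words xs n))

-- `xs` lists every element of A₁ exactly once, as seen by summation.
Enumerates : DecidableEquality A₁ → List A₁ → Set
Enumerates {A₁ = A₁} _≟′_ xs = ∀ a (φ : A₁ → ℕ) → (∑[ x ∈ xs ] (𝟙 (does (a ≟′ x)) * φ x)) ≡ φ a

bools : List Bool
bools = false ∷ true ∷ []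

bools-enumerate : Enumerates Bool._≟_ bools
bools-enumerate false φ = trans (+-identityʳ (φ false + 0)) (+-identityʳ _)
bools-enumerate true  φ = trans (+-identityʳ (φ true + 0)) (+-identityʳ _)

words-enumerate : ∀ {_≟′_ : DecidableEquality A₁} {xs} → Enumerates _≟′_ xs →
                  ∀ n → Enumerates (Vec.≡-dec {n = n} _≟′_) (words xs n)
words-enumerate enum zero [] φ = trans (+-identityʳ (φ [] + 0)) (+-identityʳ _)
words-enumerate {_≟′_ = _≟′_} {xs} enum (suc n) (a ∷ v) φ = begin
  (∑[ w ∈ words xs (suc n) ] (𝟙 (does (Vec.≡-dec _≟′_ (a ∷ v) w)) * φ w))
    ≡⟨ ∑-words-suc xs n _ ⟩
  (∑[ x ∈ xs ] ∑[ w ∈ words xs n ] (𝟙 (does (a ≟′ x) ∧ does (Vec.≡-dec _≟′_ v w)) * φ (x ∷ w)))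
    ≡⟨ ∑-cong xs (λ x → trans (∑-cong (words xs n) (λ w → trans
         (cong (_* φ (x ∷ w)) (𝟙-∧ (does (a ≟′ x)) _)) (*-assoc (𝟙 (does (a ≟′ x))) _ _)))
         (∑-*ˡ (words xs n) (𝟙 (does (a ≟′ x))) _)) ⟩
  (∑[ x ∈ xs ] (𝟙 (does (a ≟′ x)) * (∑[ w ∈ words xs n ] (𝟙 (does (Vec.≡-dec _≟′_ v w)) * φ (x ∷ w)))))
    ≡⟨ enum a _ ⟩
  (∑[ w ∈ words xs n ] (𝟙 (does (Vec.≡-dec _≟′_ v w)) * φ (a ∷ w)))
    ≡⟨ words-enumerate enum n v (λ w → φ (a ∷ w)) ⟩
  φ (a ∷ v) ∎
  where open ≡-Reasoning

-- A joint seed becomes a vector, which can be summed one coordinate at a time. The two sides run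
-- through functions that agree only pointwise, hence the hypothesis that `φ` respects pointwise
-- equality.
∑-finToFun : ∀ s n (φ : (Fin n → Fin s) → ℕ) → (∀ {f g} → (∀ i → f i ≡ g i) → φ f ≡ φ g) →
  (∑[ ω ∈ allFin (s ^ n) ] φ (finToFun ω)) ≡ (∑[ ρ ∈ words (allFin s) n ] φ (lookup ρ))
∑-finToFun s zero    φ ext = cong (_+ 0) (ext λ ())
∑-finToFun s (suc n) φ ext = begin
  (∑[ ω ∈ allFin (s * s ^ n) ] φ (finToFun ω))
    ≡⟨ ∑-allFin-* s (s ^ n) _ ⟩
  (∑[ a ∈ allFin s ] ∑[ ω ∈ allFin (s ^ n) ] φ (finToFun (combine a ω)))
    ≡⟨ ∑-cong (allFin s) (λ a → ∑-cong (allFin (s ^ n)) (λ ω → ext (split a ω))) ⟩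
  (∑[ a ∈ allFin s ] ∑[ ω ∈ allFin (s ^ n) ] φ (cons a (finToFun ω)))
    ≡⟨ ∑-cong (allFin s) (λ a → ∑-finToFun s n (φ ∘ cons a) (λ f≗g → ext λ { zero → refl ; (suc i) → f≗g i })) ⟩
  (∑[ a ∈ allFin s ] ∑[ ρ ∈ words (allFin s) n ] φ (cons a (lookup ρ)))
    ≡⟨ ∑-cong (allFin s) (λ a → ∑-cong (words (allFin s) n) (λ ρ → ext λ { zero → refl ; (suc i) → refl })) ⟩
  (∑[ a ∈ allFin s ] ∑[ ρ ∈ words (allFin s) n ] φ (lookup (a ∷ ρ)))
    ≡⟨ ∑-words-suc (allFin s) n _ ⟨
  (∑[ ρ ∈ words (allFin s) (suc n) ] φ (lookup ρ)) ∎
  where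
  open ≡-Reasoning
  cons : Fin s → (Fin n → Fin s) → Fin (suc n) → Fin s
  cons a f zero    = a
  cons a f (suc i) = f i
  split : ∀ a ω i → finToFun {s} {suc n} (combine a ω) i ≡ cons a (finToFun ω) i
  split a ω zero    = cong proj₁ (Fin.remQuot-combine {s} a ω)
  split a ω (suc i) = cong (λ rq → finToFun (proj₂ rq) i) (Fin.remQuot-combine {s} a ω)

mix : (Fin N → Bool) → Vec A₁ N → Vec A₁ N → Vec A₁ N
mix p []      []      = []
mix p (a ∷ u) (b ∷ v) = (if p zero then a else b) ∷ mix (p ∘ suc) u v

lookup-mix : ∀ (p : Fin N → Bool) (u v : Vec A₁ N) i →
             lookup (mix p u v) i ≡ (if p i then lookup u i else lookup v i)
lookup-mix p (a ∷ u) (b ∷ v) zero    = refl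
lookup-mix p (a ∷ u) (b ∷ v) (suc i) = lookup-mix (p ∘ suc) u v i

-- Each word arises from `length xs ^ n` pairs, one for every choice of the entries that `mix`
-- discards. For seeds this trades one joint seed for two independent ones, one per player.
∑-mix : ∀ (xs : List A₁) n (p : Fin n → Bool) φ →
  (∑[ u ∈ words xs n ] ∑[ v ∈ words xs n ] φ (mix p u v)) ≡ length xs ^ n * ∑ (words xs n) φ
∑-mix xs zero    p φ = refl
∑-mix xs (suc n) p φ = begin
  (∑[ u ∈ words xs (suc n) ] ∑[ v ∈ words xs (suc n) ] φ (mix p u v))
    ≡⟨ trans (∑-words-suc xs n _) (∑-cong xs (λ a → ∑-cong (words xs n) (λ u → ∑-words-suc xs n _))) ⟩
  (∑[ a ∈ xs ] ∑[ u ∈ words xs n ] ∑[ b ∈ xs ] ∑[ v ∈ words xs n ] φ ((if p zero then a else b) ∷ mix (p ∘ suc) u v))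
    ≡⟨ ∑-cong xs (λ a → ∑-swap (words xs n) xs _) ⟩
  (∑[ a ∈ xs ] ∑[ b ∈ xs ] ∑[ u ∈ words xs n ] ∑[ v ∈ words xs n ] φ ((if p zero then a else b) ∷ mix (p ∘ suc) u v))
    ≡⟨ ∑-cong xs (λ a → ∑-cong xs (λ b → ∑-mix xs n (p ∘ suc) _)) ⟩
  (∑[ a ∈ xs ] ∑[ b ∈ xs ] (length xs ^ n * (∑[ v ∈ words xs n ] φ ((if p zero then a else b) ∷ v))))
    ≡⟨ choose (p zero) (λ a → length xs ^ n * (∑[ v ∈ words xs n ] φ (a ∷ v))) ⟩
  length xs * (∑[ a ∈ xs ] (length xs ^ n * (∑[ v ∈ words xs n ] φ (a ∷ v))))
    ≡⟨ cong (length xs *_) (∑-*ˡ xs (length xs ^ n) _) ⟩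
  length xs * (length xs ^ n * (∑[ a ∈ xs ] ∑[ v ∈ words xs n ] φ (a ∷ v)))
    ≡⟨ *-assoc (length xs) _ _ ⟨
  length xs ^ suc n * (∑[ a ∈ xs ] ∑[ v ∈ words xs n ] φ (a ∷ v))
    ≡⟨ cong (length xs ^ suc n *_) (∑-words-suc xs n φ) ⟨
  length xs ^ suc n * ∑ (words xs (suc n)) φ ∎
  where
  open ≡-Reasoning
  choose : ∀ b ψ → (∑[ x ∈ xs ] ∑[ y ∈ xs ] ψ (if b then x else y)) ≡ length xs * ∑ xs ψ
  choose true  ψ = trans (∑-cong xs (λ x → ∑-const xs (ψ x))) (∑-*ˡ xs (length xs) ψ)
  choose false ψ = ∑-const xs (∑ xs ψ)

-- Sums over the cube

^-distribʳ-* : ∀ k m n → (m * n) ^ k ≡ m ^ k * n ^ k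
^-distribʳ-* zero    m n = refl
^-distribʳ-* (suc k) m n = trans (cong (m * n *_) (^-distribʳ-* k m n)) (*-interchange m n (m ^ k) (n ^ k))

cube : ∀ N → List (Vec Bool N)
cube = words bools

∑-cube-suc : ∀ N (φ : Vec Bool (suc N) → ℕ) →
  ∑ (cube (suc N)) φ ≡ ∑ (cube N) (φ ∘ (false ∷_)) + ∑ (cube N) (φ ∘ (true ∷_))
∑-cube-suc N φ = trans (∑-words-suc bools N φ) (cong (∑ (cube N) (φ ∘ (false ∷_)) +_) (+-identityʳ _))

length-cube : ∀ N → length (cube N) ≡ 2 ^ N
length-cube = length-words bools

∑-update : ∀ (i : Fin N) (φ : Vec Bool N → ℕ) →
  (∑[ x ∈ cube N ] φ (x [ i ]≔ false)) + (∑[ x ∈ cube N ] φ (x [ i ]≔ true)) ≡ 2 * ∑ (cube N) φ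
∑-update {suc N} zero φ = begin
  (∑[ x ∈ cube (suc N) ] φ (x [ zero ]≔ false)) + (∑[ x ∈ cube (suc N) ] φ (x [ zero ]≔ true))
    ≡⟨ cong₂ _+_ (∑-cube-suc N _) (∑-cube-suc N _) ⟩
  ∑ (cube N) (φ ∘ (false ∷_)) + ∑ (cube N) (φ ∘ (false ∷_)) + (∑ (cube N) (φ ∘ (true ∷_)) + ∑ (cube N) (φ ∘ (true ∷_)))
    ≡⟨ double (∑ (cube N) (φ ∘ (false ∷_))) (∑ (cube N) (φ ∘ (true ∷_))) ⟩
  2 * (∑ (cube N) (φ ∘ (false ∷_)) + ∑ (cube N) (φ ∘ (true ∷_)))
    ≡⟨ cong (2 *_) (∑-cube-suc N φ) ⟨
  2 * ∑ (cube (suc N)) φ ∎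
  where
  open ≡-Reasoning
  double : ∀ a b → a + a + (b + b) ≡ 2 * (a + b)
  double = solve-∀
∑-update {suc N} (suc i) φ = begin
  (∑[ x ∈ cube (suc N) ] φ (x [ suc i ]≔ false)) + (∑[ x ∈ cube (suc N) ] φ (x [ suc i ]≔ true))
    ≡⟨ cong₂ _+_ (∑-cube-suc N _) (∑-cube-suc N _) ⟩
  part false false + part true false + (part false true + part true true)
    ≡⟨ +-interchange (part false false) (part true false) (part false true) (part true true) ⟩
  (part false false + part false true) + (part true false + part true true)
    ≡⟨ cong₂ _+_ (∑-update i (φ ∘ (false ∷_))) (∑-update i (φ ∘ (true ∷_))) ⟩
  2 * ∑ (cube N) (φ ∘ (false ∷_)) + 2 * ∑ (cube N) (φ ∘ (true ∷_))
    ≡⟨ *-distribˡ-+ 2 (∑ (cube N) (φ ∘ (false ∷_))) _ ⟨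
  2 * (∑ (cube N) (φ ∘ (false ∷_)) + ∑ (cube N) (φ ∘ (true ∷_)))
    ≡⟨ cong (2 *_) (∑-cube-suc N φ) ⟨
  2 * ∑ (cube (suc N)) φ ∎
  where
  open ≡-Reasoning
  part : Bool → Bool → ℕ
  part a b = ∑[ x ∈ cube N ] φ (a ∷ (x [ i ]≔ b))

-- Overwriting coordinate `i` by `b` reaches every point with that bit exactly twice, so a face
-- doubles as a conditional sum.
∑-restrict : ∀ (i : Fin N) b (φ : Vec Bool N → ℕ) →
  2 * (∑[ x ∈ cube N ] (φ x * 𝟙 (does (b Bool.≟ lookup x i)))) ≡ (∑[ x ∈ cube N ] φ (x [ i ]≔ b))
∑-restrict {N} i b φ = begin
  2 * ∑ (cube N) ψ                                                             ≡⟨ ∑-update i ψ ⟨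
  (∑[ x ∈ cube N ] ψ (x [ i ]≔ false)) + (∑[ x ∈ cube N ] ψ (x [ i ]≔ true))   ≡⟨ cong₂ _+_ (∑-cong (cube N) (at false)) (∑-cong (cube N) (at true)) ⟩
  (∑[ x ∈ cube N ] (φ (x [ i ]≔ false) * 𝟙 (does (b Bool.≟ false))))
    + (∑[ x ∈ cube N ] (φ (x [ i ]≔ true) * 𝟙 (does (b Bool.≟ true))))         ≡⟨ cong₂ _+_ (∑-*ʳ (cube N) _ _) (∑-*ʳ (cube N) _ _) ⟩
  face false * 𝟙 (does (b Bool.≟ false)) + face true * 𝟙 (does (b Bool.≟ true)) ≡⟨ select b ⟩
  face b ∎
  where
  open ≡-Reasoning
  ψ : Vec Bool N → ℕ
  ψ x = φ x * 𝟙 (does (b Bool.≟ lookup x i))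
  at : ∀ c x → ψ (x [ i ]≔ c) ≡ φ (x [ i ]≔ c) * 𝟙 (does (b Bool.≟ c))
  at c x = cong (λ d → φ (x [ i ]≔ c) * 𝟙 (does (b Bool.≟ d))) (Vec.lookup∘updateAt i x)
  face : Bool → ℕ
  face c = ∑[ x ∈ cube N ] φ (x [ i ]≔ c)
  select : ∀ b → face false * 𝟙 (does (b Bool.≟ false)) + face true * 𝟙 (does (b Bool.≟ true)) ≡ face b
  select false = trans (cong₂ _+_ (*-identityʳ (face false)) (*-zeroʳ (face true))) (+-identityʳ _)
  select true  = cong₂ _+_ (*-zeroʳ (face false)) (*-identityʳ (face true))

-- Biased coordinates

-- `just b` marks a coordinate as biased towards `b`; `nothing` leaves it unmarked.
Signs : ℕ → Set
Signs N = Fin N → Maybe Bool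

size : Maybe Bool → ℕ
size nothing  = 0
size (just _) = 1

count : Signs N → ℕ
count {N} s = ∑ (allFin N) (size ∘ s)

count-suc : ∀ (s : Signs (suc N)) → count s ≡ size (s zero) + count (s ∘ suc)
count-suc s = ∑-allFin-suc _ (size ∘ s)

match : Maybe Bool → Bool → ℕ
match nothing  c = 0
match (just b) c = 𝟙 (does (b Bool.≟ c))

agree : Signs N → Vec Bool N → ℕ
agree {N} s x = ∑[ i ∈ allFin N ] match (s i) (lookup x i)

_◂_ : Maybe Bool → Signs N → Signs (suc N)
(u ◂ s) zero    = u
(u ◂ s) (suc i) = s i

-- The exponents of the deviation bound are fixed in advance, so surplus marks are erased until
-- exactly `L` are left.
trim : ∀ N (s : Signs N) L → L ≤ count s →
       ∃[ t ] (∀ i b → t i ≡ just b → s i ≡ just b) × count t ≡ L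
trim N s zero L≤ = (λ _ → nothing) , (λ _ _ ()) , ∑-zero (allFin N)
trim zero s (suc L) ()
trim (suc N) s (suc L) L≤ with s zero in eq | subst (suc L ≤_) (count-suc s) L≤
... | nothing | L≤′ with t , t⊆ , t# ← trim N (s ∘ suc) (suc L) L≤′ =
  nothing ◂ t , (λ { (suc i) b → t⊆ i b }) , trans (count-suc (nothing ◂ t)) t#
... | just c | L≤′ with t , t⊆ , t# ← trim N (s ∘ suc) L (s≤s⁻¹ L≤′) =
  just c ◂ t , (λ { zero b refl → eq ; (suc i) b → t⊆ i b }) , trans (count-suc (just c ◂ t)) (cong suc t#)

-- Tilting by 1 ± 1/8, with the denominators cleared.
weight₁ : Maybe Bool → Bool → ℕ
weight₁ nothing  c = 8
weight₁ (just b) c = if does (b Bool.≟ c) then 9 else 7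

weight : Signs N → Vec Bool N → ℕ
weight s []      = 1
weight s (c ∷ x) = weight₁ (s zero) c * weight (s ∘ suc) x

∑-weight : ∀ N (s : Signs N) → ∑ (cube N) (weight s) ≡ 16 ^ N
∑-weight zero    s = refl
∑-weight (suc N) s = begin
  ∑ (cube (suc N)) (weight s)
    ≡⟨ ∑-cube-suc N (weight s) ⟩
  (∑[ x ∈ cube N ] (weight₁ (s zero) false * weight (s ∘ suc) x)) + (∑[ x ∈ cube N ] (weight₁ (s zero) true * weight (s ∘ suc) x))
    ≡⟨ cong₂ _+_ (∑-*ˡ (cube N) (weight₁ (s zero) false) _) (∑-*ˡ (cube N) (weight₁ (s zero) true) _) ⟩
  weight₁ (s zero) false * ∑ (cube N) (weight (s ∘ suc)) + weight₁ (s zero) true * ∑ (cube N) (weight (s ∘ suc))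
    ≡⟨ *-distribʳ-+ (∑ (cube N) (weight (s ∘ suc))) (weight₁ (s zero) false) _ ⟨
  (weight₁ (s zero) false + weight₁ (s zero) true) * ∑ (cube N) (weight (s ∘ suc))
    ≡⟨ cong₂ _*_ (total (s zero)) (∑-weight N (s ∘ suc)) ⟩
  16 ^ suc N ∎
  where
  open ≡-Reasoning
  total : ∀ u → weight₁ u false + weight₁ u true ≡ 16
  total nothing      = refl
  total (just false) = refl
  total (just true)  = refl

base₁ : Maybe Bool → ℕ
base₁ nothing  = 8
base₁ (just _) = 7

-- The least value of `weight s`, taken where no mark is met; each agreement multiplies it by 9/7.
base : ∀ N → Signs N → ℕ
base zero    s = 1
base (suc N) s = base₁ (s zero) * base N (s ∘ suc)

agree-∷ : ∀ (s : Signs (suc N)) c x → agree s (c ∷ x) ≡ match (s zero) c + agree (s ∘ suc) x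
agree-∷ s c x = ∑-allFin-suc _ (λ i → match (s i) (lookup (c ∷ x) i))

weight-agree : ∀ (s : Signs N) x → weight s x * 7 ^ agree s x ≡ 9 ^ agree s x * base N s
weight-agree s []      = refl
weight-agree s (c ∷ x) = begin
  w * W * 7 ^ agree s (c ∷ x)        ≡⟨ cong (λ k → w * W * 7 ^ k) (agree-∷ s c x) ⟩
  w * W * 7 ^ (e + a)                ≡⟨ cong (w * W *_) (^-distribˡ-+-* 7 e a) ⟩
  w * W * (7 ^ e * 7 ^ a)            ≡⟨ *-interchange w W (7 ^ e) (7 ^ a) ⟩
  w * 7 ^ e * (W * 7 ^ a)            ≡⟨ cong₂ _*_ (single (s zero)) (weight-agree (s ∘ suc) x) ⟩
  9 ^ e * base₁ (s zero) * (9 ^ a * base _ (s ∘ suc)) ≡⟨ *-interchange (9 ^ e) (base₁ (s zero)) (9 ^ a) _ ⟩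
  9 ^ e * 9 ^ a * base _ s           ≡⟨ cong (_* base _ s) (^-distribˡ-+-* 9 e a) ⟨
  9 ^ (e + a) * base _ s             ≡⟨ cong (λ k → 9 ^ k * base _ s) (agree-∷ s c x) ⟨
  9 ^ agree s (c ∷ x) * base _ s     ∎
  where
  open ≡-Reasoning
  w = weight₁ (s zero) c
  W = weight (s ∘ suc) x
  e = match (s zero) c
  a = agree (s ∘ suc) x
  single : ∀ u → weight₁ u c * 7 ^ match u c ≡ 9 ^ match u c * base₁ u
  single nothing  = refl
  single (just b) with does (b Bool.≟ c)
  ... | true  = refl
  ... | false = refl

base-count : ∀ N (s : Signs N) → base N s * 8 ^ count s ≡ 7 ^ count s * 8 ^ N
base-count zero    s = refl
base-count (suc N) s = begin
  base₁ (s zero) * base N (s ∘ suc) * 8 ^ count s       ≡⟨ cong (λ k → base (suc N) s * 8 ^ k) (count-suc s) ⟩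
  base₁ (s zero) * base N (s ∘ suc) * 8 ^ (e + k)       ≡⟨ cong (base (suc N) s *_) (^-distribˡ-+-* 8 e k) ⟩
  base₁ (s zero) * base N (s ∘ suc) * (8 ^ e * 8 ^ k)   ≡⟨ *-interchange (base₁ (s zero)) _ (8 ^ e) (8 ^ k) ⟩
  base₁ (s zero) * 8 ^ e * (base N (s ∘ suc) * 8 ^ k)   ≡⟨ cong₂ _*_ (single (s zero)) (base-count N (s ∘ suc)) ⟩
  7 ^ e * 8 * (7 ^ k * 8 ^ N)                           ≡⟨ *-interchange (7 ^ e) 8 (7 ^ k) (8 ^ N) ⟩
  7 ^ e * 7 ^ k * (8 * 8 ^ N)                           ≡⟨ cong (_* 8 ^ suc N) (^-distribˡ-+-* 7 e k) ⟨
  7 ^ (e + k) * 8 ^ suc N                               ≡⟨ cong (λ k → 7 ^ k * 8 ^ suc N) (count-suc s) ⟨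
  7 ^ count s * 8 ^ suc N                               ∎
  where
  open ≡-Reasoning
  e = size (s zero)
  k = count (s ∘ suc)
  single : ∀ u → base₁ u * 8 ^ size u ≡ 7 ^ size u * 8
  single nothing  = refl
  single (just _) = refl

bernoulli⁺ : ∀ d → 7 ^ d * (7 + 2 * d) ≤ 9 ^ d * 7
bernoulli⁺ zero    = ≤-refl
bernoulli⁺ (suc d) = begin
  7 * 7 ^ d * (7 + 2 * suc d)                ≤⟨ m≤m+n _ (4 * d * 7 ^ d) ⟩
  7 * 7 ^ d * (7 + 2 * suc d) + 4 * d * 7 ^ d ≡⟨ expand (7 ^ d) d ⟩
  9 * (7 ^ d * (7 + 2 * d))                  ≤⟨ *-monoʳ-≤ 9 (bernoulli⁺ d) ⟩
  9 * (9 ^ d * 7)                            ≡⟨ *-assoc 9 (9 ^ d) 7 ⟨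
  9 ^ suc d * 7                              ∎
  where
  open ≤-Reasoning
  expand : ∀ q d → 7 * q * (7 + 2 * (1 + d)) + 4 * d * q ≡ 9 * (q * (7 + 2 * d))
  expand = solve-∀

-- Slope 2/9 would be the natural one for negative exponents. The weaker slope 2/7 is that of the
-- chord of (9/7)^a over one unit step to the right, so a single line supports the function at all
-- integers on either side.
bernoulli⁻ : ∀ d → 9 ^ d * 7 ≤ 7 ^ d * 7 + 9 ^ d * (2 * d)
bernoulli⁻ zero    = ≤-refl
bernoulli⁻ (suc d) = begin
  9 * 9 ^ d * 7                                            ≡⟨ split (9 ^ d) ⟩
  7 * (9 ^ d * 7) + 14 * 9 ^ d                             ≤⟨ +-monoˡ-≤ (14 * 9 ^ d) (*-monoʳ-≤ 7 (bernoulli⁻ d)) ⟩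
  7 * (7 ^ d * 7 + 9 ^ d * (2 * d)) + 14 * 9 ^ d           ≤⟨ m≤m+n _ (4 * d * 9 ^ d + 4 * 9 ^ d) ⟩
  7 * (7 ^ d * 7 + 9 ^ d * (2 * d)) + 14 * 9 ^ d + (4 * d * 9 ^ d + 4 * 9 ^ d) ≡⟨ collect (7 ^ d) (9 ^ d) d ⟩
  7 * 7 ^ d * 7 + 9 * 9 ^ d * (2 * suc d)                  ∎
  where
  open ≤-Reasoning
  split : ∀ r → 9 * r * 7 ≡ 7 * (r * 7) + 14 * r
  split = solve-∀
  collect : ∀ q r d → 7 * (q * 7 + r * (2 * d)) + 14 * r + (4 * d * r + 4 * r) ≡ 7 * q * 7 + 9 * r * (2 * (1 + d))
  collect = solve-∀

-- Bernoulli's inequality (9/7)^(a - a₀) ≥ 1 + 2(a - a₀)/7 for an integer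
-- a - a₀ of either sign, with the denominators cleared.
bernoulli : ∀ a a₀ → 7 ^ a * 9 ^ a₀ * (7 + 2 * a) ≤ 9 ^ a * 7 ^ a₀ * 7 + 7 ^ a * 9 ^ a₀ * (2 * a₀)
bernoulli a a₀ with ≤-total a₀ a
... | inj₁ a₀≤a with d , refl ← m≤n⇒∃[o]m+o≡n a₀≤a = begin
  7 ^ (a₀ + d) * 9 ^ a₀ * (7 + 2 * (a₀ + d))
    ≡⟨ cong (λ z → z * 9 ^ a₀ * (7 + 2 * (a₀ + d))) (^-distribˡ-+-* 7 a₀ d) ⟩
  7 ^ a₀ * 7 ^ d * 9 ^ a₀ * (7 + 2 * (a₀ + d))
    ≡⟨ factor (7 ^ a₀) (9 ^ a₀) (7 ^ d) a₀ d ⟩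
  7 ^ a₀ * 9 ^ a₀ * (7 ^ d * (7 + 2 * d)) + 7 ^ a₀ * 7 ^ d * 9 ^ a₀ * (2 * a₀)
    ≤⟨ +-monoˡ-≤ _ (*-monoʳ-≤ (7 ^ a₀ * 9 ^ a₀) (bernoulli⁺ d)) ⟩
  7 ^ a₀ * 9 ^ a₀ * (9 ^ d * 7) + 7 ^ a₀ * 7 ^ d * 9 ^ a₀ * (2 * a₀)
    ≡⟨ cong (_+ 7 ^ a₀ * 7 ^ d * 9 ^ a₀ * (2 * a₀)) (regroup (7 ^ a₀) (9 ^ a₀) (9 ^ d)) ⟩
  9 ^ a₀ * 9 ^ d * 7 ^ a₀ * 7 + 7 ^ a₀ * 7 ^ d * 9 ^ a₀ * (2 * a₀)
    ≡⟨ cong₂ (λ y z → y * 7 ^ a₀ * 7 + z * 9 ^ a₀ * (2 * a₀)) (^-distribˡ-+-* 9 a₀ d) (^-distribˡ-+-* 7 a₀ d) ⟨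
  9 ^ (a₀ + d) * 7 ^ a₀ * 7 + 7 ^ (a₀ + d) * 9 ^ a₀ * (2 * a₀) ∎
  where
  open ≤-Reasoning
  factor : ∀ p r q a d → p * q * r * (7 + 2 * (a + d)) ≡ p * r * (q * (7 + 2 * d)) + p * q * r * (2 * a)
  factor = solve-∀
  regroup : ∀ p r t → p * r * (t * 7) ≡ r * t * p * 7
  regroup = solve-∀
bernoulli a a₀ | inj₂ a≤a₀ with d , refl ← m≤n⇒∃[o]m+o≡n a≤a₀ = begin
  7 ^ a * 9 ^ (a + d) * (7 + 2 * a)
    ≡⟨ cong (λ z → 7 ^ a * z * (7 + 2 * a)) (^-distribˡ-+-* 9 a d) ⟩
  7 ^ a * (9 ^ a * 9 ^ d) * (7 + 2 * a)
    ≡⟨ factor (7 ^ a) (9 ^ a) (9 ^ d) a ⟩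
  7 ^ a * 9 ^ a * (9 ^ d * 7) + 7 ^ a * (9 ^ a * 9 ^ d) * (2 * a)
    ≤⟨ +-monoˡ-≤ _ (*-monoʳ-≤ (7 ^ a * 9 ^ a) (bernoulli⁻ d)) ⟩
  7 ^ a * 9 ^ a * (7 ^ d * 7 + 9 ^ d * (2 * d)) + 7 ^ a * (9 ^ a * 9 ^ d) * (2 * a)
    ≡⟨ regroup (7 ^ a) (9 ^ a) (7 ^ d) (9 ^ d) a d ⟩
  9 ^ a * (7 ^ a * 7 ^ d) * 7 + 7 ^ a * (9 ^ a * 9 ^ d) * (2 * (a + d))
    ≡⟨ cong₂ (λ y z → 9 ^ a * y * 7 + 7 ^ a * z * (2 * (a + d))) (^-distribˡ-+-* 7 a d) (^-distribˡ-+-* 9 a d) ⟨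
  9 ^ a * 7 ^ (a + d) * 7 + 7 ^ a * 9 ^ (a + d) * (2 * (a + d)) ∎
  where
  open ≤-Reasoning
  factor : ∀ p r t a → p * (r * t) * (7 + 2 * a) ≡ p * r * (t * 7) + p * (r * t) * (2 * a)
  factor = solve-∀
  regroup : ∀ p r q t a d → p * r * (q * 7 + t * (2 * d)) + p * (r * t) * (2 * a) ≡ r * (p * q) * 7 + p * (r * t) * (2 * (a + d))
  regroup = solve-∀

weight-tangent : ∀ (s : Signs N) x a₀ →
  base N s * 9 ^ a₀ * (7 + 2 * agree s x) ≤ 7 * 7 ^ a₀ * weight s x + base N s * 9 ^ a₀ * (2 * a₀)
weight-tangent {N} s x a₀ = *-cancelˡ-≤ (7 ^ a) {{m^n≢0 7 a}} (begin
  7 ^ a * (E * 9 ^ a₀ * (7 + 2 * a))                          ≡⟨ pull (7 ^ a) E (9 ^ a₀) (7 + 2 * a) ⟩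
  E * (7 ^ a * 9 ^ a₀ * (7 + 2 * a))                          ≤⟨ *-monoʳ-≤ E (bernoulli a a₀) ⟩
  E * (9 ^ a * 7 ^ a₀ * 7 + 7 ^ a * 9 ^ a₀ * (2 * a₀))        ≡⟨ spread E (9 ^ a) (7 ^ a₀) (7 ^ a * 9 ^ a₀ * (2 * a₀)) ⟩
  7 * 7 ^ a₀ * (9 ^ a * E) + E * (7 ^ a * 9 ^ a₀ * (2 * a₀))  ≡⟨ cong (λ z → 7 * 7 ^ a₀ * z + E * (7 ^ a * 9 ^ a₀ * (2 * a₀))) (weight-agree s x) ⟨
  7 * 7 ^ a₀ * (weight s x * 7 ^ a) + E * (7 ^ a * 9 ^ a₀ * (2 * a₀)) ≡⟨ push (7 * 7 ^ a₀) (weight s x) (7 ^ a) E (9 ^ a₀) (2 * a₀) ⟩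
  7 ^ a * (7 * 7 ^ a₀ * weight s x + E * 9 ^ a₀ * (2 * a₀))   ∎)
  where
  open ≤-Reasoning
  a = agree s x
  E = base N s
  pull : ∀ p e r z → p * (e * r * z) ≡ e * (p * r * z)
  pull = solve-∀
  spread : ∀ e t q z → e * (t * q * 7 + z) ≡ 7 * q * (t * e) + e * z
  spread = solve-∀
  push : ∀ u w p e r z → u * (w * p) + e * (p * r * z) ≡ p * (u * w + e * r * z)
  push = solve-∀

module _ (h : Vec Bool N → ℕ) (s : Signs N) where
  private
    F = ∑ (cube N) h

  ∑-agree : (∑[ x ∈ cube N ] (h x * agree s x)) ≡ (∑[ i ∈ allFin N ] ∑[ x ∈ cube N ] (h x * match (s i) (lookup x i)))
  ∑-agree = trans (∑-cong (cube N) (λ x → sym (∑-*ˡ (allFin N) (h x) _))) (∑-swap (cube N) (allFin N) _)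

  -- Half of a face consists of overwritten points, so a face of mass at least 9/8 of the total
  -- means that under `h` the bit is `b` with probability at least 9/16. The expected agreement is
  -- then at least 9/16 for each mark.
  agree-many : (∀ i b → s i ≡ just b → 9 * F ≤ 8 * (∑[ x ∈ cube N ] h (x [ i ]≔ b))) →
               9 * F * count s ≤ 16 * (∑[ x ∈ cube N ] (h x * agree s x))
  agree-many biased = begin
    9 * F * count s                                     ≡⟨ ∑-*ˡ (allFin N) (9 * F) (size ∘ s) ⟨
    (∑[ i ∈ allFin N ] (9 * F * size (s i)))            ≤⟨ ∑-mono (allFin N) (λ i → at i (s i) refl) ⟩
    (∑[ i ∈ allFin N ] (16 * (∑[ x ∈ cube N ] (h x * match (s i) (lookup x i))))) ≡⟨ ∑-*ˡ (allFin N) 16 _ ⟩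
    16 * (∑[ i ∈ allFin N ] ∑[ x ∈ cube N ] (h x * match (s i) (lookup x i)))     ≡⟨ cong (16 *_) ∑-agree ⟨
    16 * (∑[ x ∈ cube N ] (h x * agree s x))            ∎
    where
    open ≤-Reasoning
    at : ∀ i u → s i ≡ u → 9 * F * size u ≤ 16 * (∑[ x ∈ cube N ] (h x * match u (lookup x i)))
    at i nothing  eq = ≤-trans (≤-reflexive (*-zeroʳ (9 * F))) z≤n
    at i (just b) eq = begin
      9 * F * 1                                 ≡⟨ *-identityʳ (9 * F) ⟩
      9 * F                                     ≤⟨ biased i b eq ⟩
      8 * (∑[ x ∈ cube N ] h (x [ i ]≔ b))      ≡⟨ cong (8 *_) (∑-restrict i b h) ⟨
      8 * (2 * (∑[ x ∈ cube N ] (h x * match (just b) (lookup x i)))) ≡⟨ *-assoc 8 2 (∑[ x ∈ cube N ] (h x * match (just b) (lookup x i))) ⟨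
      16 * (∑[ x ∈ cube N ] (h x * match (just b) (lookup x i)))      ∎

  -- Jensen's inequality for a ↦ (9/7)^a, through the tangent at a₀.
  weight-convex : ∀ a₀ → a₀ * F ≤ (∑[ x ∈ cube N ] (h x * agree s x)) →
                  base N s * 9 ^ a₀ * F ≤ 7 ^ a₀ * (∑[ x ∈ cube N ] (h x * weight s x))
  weight-convex a₀ enough = *-cancelˡ-≤ 7 (+-cancelʳ-≤ (D * (2 * (a₀ * F))) _ _ (begin
    7 * (D * F) + D * (2 * (a₀ * F))          ≡⟨ collect D F (a₀ * F) ⟩
    D * (7 * F + 2 * (a₀ * F))                ≤⟨ *-monoʳ-≤ D (+-monoʳ-≤ (7 * F) (*-monoʳ-≤ 2 enough)) ⟩
    D * (7 * F + 2 * Z)                       ≡⟨ cong (λ z → D * (z + 2 * Z)) (∑-*ˡ (cube N) 7 h) ⟨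
    D * (∑ (cube N) (λ x → 7 * h x) + 2 * Z)  ≡⟨ cong (λ z → D * (∑ (cube N) (λ x → 7 * h x) + z)) (∑-*ˡ (cube N) 2 _) ⟨
    D * (∑ (cube N) (λ x → 7 * h x) + ∑ (cube N) (λ x → 2 * (h x * agree s x)))  ≡⟨ cong (D *_) (∑-+ (cube N) _ _) ⟨
    D * (∑[ x ∈ cube N ] (7 * h x + 2 * (h x * agree s x)))  ≡⟨ ∑-*ˡ (cube N) D _ ⟨
    (∑[ x ∈ cube N ] (D * (7 * h x + 2 * (h x * agree s x)))) ≤⟨ ∑-mono (cube N) pointwise ⟩
    (∑[ x ∈ cube N ] (7 * 7 ^ a₀ * (h x * weight s x) + D * (2 * a₀) * h x))   ≡⟨ ∑-+ (cube N) _ _ ⟩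
    (∑[ x ∈ cube N ] (7 * 7 ^ a₀ * (h x * weight s x))) + (∑[ x ∈ cube N ] (D * (2 * a₀) * h x))
      ≡⟨ cong₂ _+_ (∑-*ˡ (cube N) (7 * 7 ^ a₀) _) (∑-*ˡ (cube N) (D * (2 * a₀)) h) ⟩
    7 * 7 ^ a₀ * H + D * (2 * a₀) * F         ≡⟨ final (7 ^ a₀) H D a₀ F ⟩
    7 * (7 ^ a₀ * H) + D * (2 * (a₀ * F))     ∎))
    where
    open ≤-Reasoning
    D = base N s * 9 ^ a₀
    Z = ∑[ x ∈ cube N ] (h x * agree s x)
    H = ∑[ x ∈ cube N ] (h x * weight s x)
    collect : ∀ D F G → 7 * (D * F) + D * (2 * G) ≡ D * (7 * F + 2 * G)
    collect = solve-∀
    final : ∀ p H D a F → 7 * p * H + D * (2 * a) * F ≡ 7 * (p * H) + D * (2 * (a * F))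
    final = solve-∀
    pointwise : ∀ x → D * (7 * h x + 2 * (h x * agree s x)) ≤ 7 * 7 ^ a₀ * (h x * weight s x) + D * (2 * a₀) * h x
    pointwise x = begin
      D * (7 * h x + 2 * (h x * agree s x))                            ≡⟨ left D (h x) (agree s x) ⟩
      h x * (D * (7 + 2 * agree s x))                                  ≤⟨ *-monoʳ-≤ (h x) (weight-tangent s x a₀) ⟩
      h x * (7 * 7 ^ a₀ * weight s x + D * (2 * a₀))                   ≡⟨ right (h x) (7 * 7 ^ a₀) (weight s x) (D * (2 * a₀)) ⟩
      7 * 7 ^ a₀ * (h x * weight s x) + D * (2 * a₀) * h x             ∎
      where
      left : ∀ D k a → D * (7 * k + 2 * (k * a)) ≡ k * (D * (7 + 2 * a))
      left = solve-∀
      right : ∀ k u w z → k * (u * w + z) ≡ u * (k * w) + z * k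
      right = solve-∀

  -- The Chernoff argument: relative to the uniform distribution, `weight s` over `8 ^ N` is a
  -- probability density, so its sum against `h` is at most `M * 2 ^ N`. Convexity bounds that sum
  -- from below by `F` times (9/8)^a₀ · (7/8)^c₀.
  biased-small : ∀ M → (∀ x → h x ≤ M) → ∀ a₀ c₀ → count s ≡ a₀ + c₀ →
    a₀ * F ≤ (∑[ x ∈ cube N ] (h x * agree s x)) →
    7 ^ c₀ * 9 ^ a₀ * F ≤ 8 ^ (a₀ + c₀) * (M * 2 ^ N)
  biased-small M h≤M a₀ c₀ #s enough =
    *-cancelˡ-≤ (8 ^ N) {{m^n≢0 8 N}} (*-cancelˡ-≤ (7 ^ a₀) {{m^n≢0 7 a₀}} (begin
      7 ^ a₀ * (8 ^ N * (7 ^ c₀ * 9 ^ a₀ * F))    ≡⟨ e₁ (7 ^ a₀) (8 ^ N) (7 ^ c₀) (9 ^ a₀) F ⟩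
      7 ^ a₀ * 7 ^ c₀ * 8 ^ N * (9 ^ a₀ * F)      ≡⟨ cong (λ z → z * 8 ^ N * (9 ^ a₀ * F)) (^-distribˡ-+-* 7 a₀ c₀) ⟨
      7 ^ (a₀ + c₀) * 8 ^ N * (9 ^ a₀ * F)        ≡⟨ cong (λ m → 7 ^ m * 8 ^ N * (9 ^ a₀ * F)) #s ⟨
      7 ^ count s * 8 ^ N * (9 ^ a₀ * F)          ≡⟨ cong (_* (9 ^ a₀ * F)) (base-count N s) ⟨
      base N s * 8 ^ count s * (9 ^ a₀ * F)       ≡⟨ cong (λ m → base N s * 8 ^ m * (9 ^ a₀ * F)) #s ⟩
      base N s * L * (9 ^ a₀ * F)                 ≡⟨ e₂ (base N s) L (9 ^ a₀) F ⟩
      L * (base N s * 9 ^ a₀ * F)                 ≤⟨ *-monoʳ-≤ L (weight-convex a₀ enough) ⟩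
      L * (7 ^ a₀ * (∑[ x ∈ cube N ] (h x * weight s x))) ≤⟨ *-monoʳ-≤ L (*-monoʳ-≤ (7 ^ a₀) (∑-mono (cube N) (λ x → *-monoˡ-≤ (weight s x) (h≤M x)))) ⟩
      L * (7 ^ a₀ * (∑[ x ∈ cube N ] (M * weight s x)))   ≡⟨ cong (λ z → L * (7 ^ a₀ * z)) (trans (∑-*ˡ (cube N) M _) (cong (M *_) (∑-weight N s))) ⟩
      L * (7 ^ a₀ * (M * 16 ^ N))                 ≡⟨ cong (λ z → L * (7 ^ a₀ * (M * z))) (^-distribʳ-* N 8 2) ⟩
      L * (7 ^ a₀ * (M * (8 ^ N * 2 ^ N)))        ≡⟨ e₃ L (7 ^ a₀) M (8 ^ N) (2 ^ N) ⟩
      7 ^ a₀ * (8 ^ N * (L * (M * 2 ^ N)))        ∎))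
    where
    open ≤-Reasoning
    L = 8 ^ (a₀ + c₀)
    e₁ : ∀ p q r s F → p * (q * (r * s * F)) ≡ p * r * q * (s * F)
    e₁ = solve-∀
    e₂ : ∀ b k s F → b * k * (s * F) ≡ k * (b * s * F)
    e₂ = solve-∀
    e₃ : ∀ k p M q t → k * (p * (M * (q * t))) ≡ p * (q * (k * (M * t)))
    e₃ = solve-∀

-- Of 96 j biased coordinates the fraction (1 + 1/8) / 2 agrees, that is 54 j of them.
deviation : ∀ j {X Y} → 7 ^ (42 * j) * 9 ^ (54 * j) * X ≤ 8 ^ (54 * j + 42 * j) * Y → X * 2 ^ j ≤ Y
deviation j {X} {Y} le = *-cancelˡ-≤ (8 ^ (54 * j + 42 * j)) {{m^n≢0 8 (54 * j + 42 * j)}} (begin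
  8 ^ (54 * j + 42 * j) * (X * 2 ^ j)   ≡⟨ cong (λ z → z * (X * 2 ^ j)) (trans (cong (8 ^_) (sym (*-distribʳ-+ j 54 42))) (sym (^-*-assoc 8 96 j))) ⟩
  (8 ^ 96) ^ j * (X * 2 ^ j)            ≡⟨ regroup ((8 ^ 96) ^ j) X (2 ^ j) ⟩
  (8 ^ 96) ^ j * 2 ^ j * X              ≡⟨ cong (_* X) (^-distribʳ-* j (8 ^ 96) 2) ⟨
  -- The quotient of `7 ^ 42 * 9 ^ 54` by `8 ^ 96` is about 2.12. For 9/16 of the marks to be an
  -- integer their number must be a multiple of 16, and 96 is the least one at which this quotient
  -- reaches 2.
  (8 ^ 96 * 2) ^ j * X                  ≤⟨ *-monoˡ-≤ X (^-monoˡ-≤ j (≤ᵇ⇒≤ (8 ^ 96 * 2) (7 ^ 42 * 9 ^ 54) _)) ⟩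
  (7 ^ 42 * 9 ^ 54) ^ j * X             ≡⟨ cong (_* X) (^-distribʳ-* j (7 ^ 42) (9 ^ 54)) ⟩
  (7 ^ 42) ^ j * (9 ^ 54) ^ j * X       ≡⟨ cong₂ (λ y z → y * z * X) (^-*-assoc 7 42 j) (^-*-assoc 9 54 j) ⟩
  7 ^ (42 * j) * 9 ^ (54 * j) * X       ≤⟨ le ⟩
  8 ^ (54 * j + 42 * j) * Y             ∎)
  where
  open ≤-Reasoning
  regroup : ∀ k X t → k * (X * t) ≡ k * t * X
  regroup = solve-∀

∑-cube-≤ : ∀ (h : Vec Bool N → ℕ) M → (∀ x → h x ≤ M) → ∑ (cube N) h ≤ M * 2 ^ N
∑-cube-≤ {N} h M h≤M = begin
  ∑ (cube N) h          ≤⟨ ∑-mono (cube N) h≤M ⟩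
  (∑[ _ ∈ cube N ] M)   ≡⟨ trans (∑-const (cube N) M) (*-comm _ M) ⟩
  M * length (cube N)   ≡⟨ cong (M *_) (length-cube N) ⟩
  M * 2 ^ N             ∎
  where open ≤-Reasoning

count≤N : ∀ (s : Signs N) → count s ≤ N
count≤N {N} s = begin
  count s                     ≤⟨ ∑-mono (allFin N) (λ i → size≤1 (s i)) ⟩
  (∑[ _ ∈ allFin N ] 1)       ≡⟨ length-∑ (allFin N) ⟩
  length (allFin N)           ≡⟨ List.length-tabulate id ⟩
  N                           ∎
  where
  open ≤-Reasoning
  size≤1 : ∀ u → size u ≤ 1
  size≤1 nothing  = z≤n
  size≤1 (just _) = ≤-refl

module _ (h : Vec Bool N → ℕ) where

  total : ℕ
  total = ∑ (cube N) h

  face : Fin N → Bool → ℕ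
  face i b = ∑[ x ∈ cube N ] h (x [ i ]≔ b)

  -- The two faces average to `total`, so at most one exceeds it by more than an eighth and the
  -- order of the tests does not matter.
  sign : Signs N
  sign i with 9 * total <? 8 * face i false | 9 * total <? 8 * face i true
  ... | yes _ | _     = just false
  ... | no  _ | yes _ = just true
  ... | no  _ | no  _ = nothing

  sign-just : ∀ i b → sign i ≡ just b → 9 * total ≤ 8 * face i b
  sign-just i b eq with 9 * total <? 8 * face i false | 9 * total <? 8 * face i true
  sign-just i .false refl | yes p | _     = <⇒≤ p
  sign-just i .true  refl | no  _ | yes p = <⇒≤ p

  sign-nothing : ∀ i b → sign i ≡ nothing → 8 * face i b ≤ 9 * total
  sign-nothing i b     eq with 9 * total <? 8 * face i false | 9 * total <? 8 * face i true
  sign-nothing i false eq | no p | no _ = ≮⇒≥ p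
  sign-nothing i true  eq | no _ | no p = ≮⇒≥ p

  many-biased⇒small : ∀ M → (∀ x → h x ≤ M) → ∀ j → 96 * j ≤ count sign → total * 2 ^ j ≤ M * 2 ^ N
  many-biased⇒small M h≤M j many with t , t⊆ , t# ← trim N sign (96 * j) many =
    deviation j (biased-small h t M h≤M (54 * j) (42 * j) (trans t# (*-distribʳ-+ j 54 42))
      (*-cancelˡ-≤ 16 (begin
        16 * (54 * j * total)                          ≡⟨ rescale j total ⟩
        9 * total * (96 * j)                           ≡⟨ cong (9 * total *_) t# ⟨
        9 * total * count t                            ≤⟨ agree-many h t (λ i b eq → sign-just i b (t⊆ i b eq)) ⟩
        16 * (∑[ x ∈ cube N ] (h x * agree t x))       ∎)))
    where
    open ≤-Reasoning
    rescale : ∀ j F → 16 * (54 * j * F) ≡ 9 * F * (96 * j)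
    rescale = solve-∀

  -- Either at most `96 * j` coordinates are biased, or `h` has density at most 2^-j and the trivial
  -- bound `N` on their number is good enough. The two bounds are added, so that one inequality can
  -- be summed over all z; `G` stands for the row of the other player.
  count-sign-* : ∀ M → (∀ x → h x ≤ M) → ∀ j {G K} → G ≤ K →
    count sign * (total * G) * 2 ^ j ≤ 96 * j * 2 ^ j * (total * G) + N * (M * 2 ^ N * K)
  count-sign-* M h≤M j {G} {K} G≤K with ≤-total (96 * j) (count sign)
  ... | inj₁ many = begin
    count sign * (total * G) * 2 ^ j       ≤⟨ *-monoˡ-≤ (2 ^ j) (*-monoˡ-≤ (total * G) (count≤N sign)) ⟩
    N * (total * G) * 2 ^ j                ≡⟨ regroup N total G (2 ^ j) ⟩
    N * (total * 2 ^ j * G)                ≤⟨ *-monoʳ-≤ N (*-mono-≤ (many-biased⇒small M h≤M j many) G≤K) ⟩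
    N * (M * 2 ^ N * K)                    ≤⟨ m≤n+m _ _ ⟩
    96 * j * 2 ^ j * (total * G) + N * (M * 2 ^ N * K) ∎
    where
    open ≤-Reasoning
    regroup : ∀ N F G t → N * (F * G) * t ≡ N * (F * t * G)
    regroup = solve-∀
  ... | inj₂ few = begin
    count sign * (total * G) * 2 ^ j       ≤⟨ *-monoˡ-≤ (2 ^ j) (*-monoˡ-≤ (total * G) few) ⟩
    96 * j * (total * G) * 2 ^ j           ≡⟨ regroup (96 * j) (total * G) (2 ^ j) ⟩
    96 * j * 2 ^ j * (total * G)           ≤⟨ m≤m+n _ _ ⟩
    96 * j * 2 ^ j * (total * G) + N * (M * 2 ^ N * K) ∎
    where
    open ≤-Reasoning
    regroup : ∀ c F t → c * F * t ≡ c * t * F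
    regroup = solve-∀

-- Corruption

infixl 7 _⊓ᵛ_
_⊓ᵛ_ : Vec Bool N → Vec Bool N → Vec Bool N
_⊓ᵛ_ = zipWith _∧_

¬ᵛ_ : Vec Bool N → Vec Bool N
¬ᵛ_ = Vec.map not

-- Meeting a uniform point of the whole cube with `z` gives a uniform subset of `z`, with the same
-- normalisation `2 ^ N` for every `z`.
row : (Vec Bool N → ℕ) → Vec Bool N → ℕ
row {N} f z = ∑[ x ∈ cube N ] f (x ⊓ᵛ z)

forced : (Vec Bool N → ℕ) → Fin N → Vec Bool N → ℕ
forced {N} f i z = ∑[ x ∈ cube N ] f ((x ⊓ᵛ z) [ i ]≔ true)

⊓ᵛ-update-true : ∀ (i : Fin N) b x z → (x [ i ]≔ b) ⊓ᵛ (z [ i ]≔ true) ≡ (x ⊓ᵛ z) [ i ]≔ b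
⊓ᵛ-update-true zero    b (_ ∷ x) (_ ∷ z) = cong (_∷ x ⊓ᵛ z) (Bool.∧-identityʳ b)
⊓ᵛ-update-true (suc i) b (a ∷ x) (c ∷ z) = cong ((a ∧ c) ∷_) (⊓ᵛ-update-true i b x z)

⊓ᵛ-update-false : ∀ (i : Fin N) x z → x ⊓ᵛ (z [ i ]≔ false) ≡ (x ⊓ᵛ z) [ i ]≔ false
⊓ᵛ-update-false zero    (a ∷ x) (_ ∷ z) = cong (_∷ x ⊓ᵛ z) (Bool.∧-zeroʳ a)
⊓ᵛ-update-false (suc i) (a ∷ x) (c ∷ z) = cong ((a ∧ c) ∷_) (⊓ᵛ-update-false i x z)

¬ᵛ-update : ∀ (i : Fin N) b z → ¬ᵛ (z [ i ]≔ b) ≡ (¬ᵛ z) [ i ]≔ not b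
¬ᵛ-update i b z = Vec.map-[]≔ not z i

module _ (f : Vec Bool N → ℕ) where

  slice : Vec Bool N → Vec Bool N → ℕ
  slice z x = f (x ⊓ᵛ z)

  face-false : ∀ i z → face (slice (z [ i ]≔ true)) i false ≡ row f (z [ i ]≔ false)
  face-false i z = ∑-cong (cube N) (λ x → cong f (trans (⊓ᵛ-update-true i false x z) (sym (⊓ᵛ-update-false i x z))))

  face-true : ∀ i z → face (slice (z [ i ]≔ true)) i true ≡ forced f i z
  face-true i z = ∑-cong (cube N) (λ x → cong f (⊓ᵛ-update-true i true x z))

  biased : Vec Bool N → Fin N → ℕ
  biased z i = size (sign (slice z) i)

-- r₁ and r₀ are the masses of a row with the coordinate free and cleared, ur
-- that with the coordinate set, so r₁ is the average of r₀ and ur.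
data Balance (r₁ r₀ ur : ℕ) : ℕ → Set where
  fair   : 8 * r₀ ≤ 9 * r₁ → 8 * ur ≤ 9 * r₁ → Balance r₁ r₀ ur 0
  unfair : Balance r₁ r₀ ur 1

balance : ∀ (f : Vec Bool N → ℕ) i z →
  Balance (row f (z [ i ]≔ true)) (row f (z [ i ]≔ false)) (forced f i z) (biased f (z [ i ]≔ true) i)
balance f i z with sign (slice f (z [ i ]≔ true)) i in eq
... | just _  = unfair
... | nothing = fair
  (subst (λ k → 8 * k ≤ 9 * row f (z [ i ]≔ true)) (face-false f i z) (sign-nothing (slice f (z [ i ]≔ true)) i false eq))
  (subst (λ k → 8 * k ≤ 9 * row f (z [ i ]≔ true)) (face-true f i z) (sign-nothing (slice f (z [ i ]≔ true)) i true eq))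

average : ∀ (f : Vec Bool N → ℕ) i z → row f (z [ i ]≔ false) + forced f i z ≡ 2 * row f (z [ i ]≔ true)
average f i z = trans (cong₂ _+_ (sym (face-false f i z)) (sym (face-true f i z))) (∑-update i (slice f (z [ i ]≔ true)))

complement-≤ : ∀ {a b r} → a + b ≡ 2 * r → 8 * a ≤ 9 * r → 7 * r ≤ 8 * b
complement-≤ {a} {b} {r} a+b≡2r 8a≤9r = +-cancelˡ-≤ (9 * r) _ _ (begin
  9 * r + 7 * r   ≡⟨ sixteen r ⟩
  8 * (2 * r)     ≡⟨ cong (8 *_) a+b≡2r ⟨
  8 * (a + b)     ≡⟨ *-distribˡ-+ 8 a b ⟩
  8 * a + 8 * b   ≤⟨ +-monoˡ-≤ (8 * b) 8a≤9r ⟩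
  9 * r + 8 * b   ∎)
  where
  open ≤-Reasoning
  sixteen : ∀ r → 9 * r + 7 * r ≡ 8 * (2 * r)
  sixteen = solve-∀

-- When only the row side is fair, both cells are to be charged to the one where the unfair side is
-- free. Fairness gives r₀ ≥ 7/8 · r₁ and the average alone gives c₁ ≤ 2 · c₀, hence a factor 16/7,
-- below 3.
fair-unfair : ∀ {r₁ r₀ ur c₁ c₀ uc} → r₀ + ur ≡ 2 * r₁ → c₁ + uc ≡ 2 * c₀ → 8 * ur ≤ 9 * r₁ → r₁ * c₁ ≤ 3 * (r₀ * c₀)
fair-unfair {r₁} {r₀} {ur} {c₁} {c₀} {uc} r≡ c≡ 8ur≤9r₁ = *-cancelˡ-≤ 7 (begin
  7 * (r₁ * c₁)               ≡⟨ *-assoc 7 r₁ c₁ ⟨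
  7 * r₁ * c₁                 ≤⟨ *-mono-≤ (complement-≤ {ur} {r₀} {r₁} (trans (+-comm ur r₀) r≡) 8ur≤9r₁) (m+n≤o⇒m≤o c₁ (≤-reflexive c≡)) ⟩
  8 * r₀ * (2 * c₀)           ≤⟨ m≤m+n _ (5 * (r₀ * c₀)) ⟩
  8 * r₀ * (2 * c₀) + 5 * (r₀ * c₀) ≡⟨ collect r₀ c₀ ⟩
  7 * (3 * (r₀ * c₀))         ∎)
  where
  open ≤-Reasoning
  collect : ∀ r c → 8 * r * (2 * c) + 5 * (r * c) ≡ 7 * (3 * (r * c))
  collect = solve-∀

-- A cleared mass is at most 9/8 of the free one and a forced mass at least 7/8 of it, so the claim
-- reduces to 72 + 72 ≤ 3 · 49. The threshold 1/8 cannot be relaxed to 1/7 here: that would ask for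
-- 56 + 56 ≤ 3 · 36.
fair-fair : ∀ {r₁ r₀ ur c₁ c₀ uc} → r₀ + ur ≡ 2 * r₁ → c₁ + uc ≡ 2 * c₀ →
  8 * r₀ ≤ 9 * r₁ → 8 * c₁ ≤ 9 * c₀ → r₁ * c₁ + r₀ * c₀ ≤ 3 * (ur * uc)
fair-fair {r₁} {r₀} {ur} {c₁} {c₀} {uc} r≡ c≡ 8r₀≤9r₁ 8c₁≤9c₀ = *-cancelˡ-≤ 64 (begin
  64 * (r₁ * c₁ + r₀ * c₀)              ≡⟨ e₁ r₁ c₁ r₀ c₀ ⟩
  8 * r₁ * (8 * c₁) + 8 * r₀ * (8 * c₀) ≤⟨ +-mono-≤ (*-monoʳ-≤ (8 * r₁) 8c₁≤9c₀) (*-monoˡ-≤ (8 * c₀) 8r₀≤9r₁) ⟩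
  8 * r₁ * (9 * c₀) + 9 * r₁ * (8 * c₀) ≤⟨ m≤m+n _ (3 * (r₁ * c₀)) ⟩
  8 * r₁ * (9 * c₀) + 9 * r₁ * (8 * c₀) + 3 * (r₁ * c₀) ≡⟨ e₂ r₁ c₀ ⟩
  3 * (7 * r₁ * (7 * c₀))               ≤⟨ *-monoʳ-≤ 3 (*-mono-≤ (complement-≤ {r₀} {ur} {r₁} r≡ 8r₀≤9r₁) (complement-≤ {c₁} {uc} {c₀} c≡ 8c₁≤9c₀)) ⟩
  3 * (8 * ur * (8 * uc))               ≡⟨ e₃ ur uc ⟩
  64 * (3 * (ur * uc))                  ∎)
  where
  open ≤-Reasoning
  e₁ : ∀ a b c d → 64 * (a * b + c * d) ≡ 8 * a * (8 * b) + 8 * c * (8 * d)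
  e₁ = solve-∀
  e₂ : ∀ r c → 8 * r * (9 * c) + 9 * r * (8 * c) + 3 * (r * c) ≡ 3 * (7 * r * (7 * c))
  e₂ = solve-∀
  e₃ : ∀ a b → 3 * (8 * a * (8 * b)) ≡ 64 * (3 * (a * b))
  e₃ = solve-∀

-- `bx` and `by` each weigh the cell in which their own side is free, because that is where the bias
-- is measured. Summed over the coordinates, a cell is therefore charged in proportion to its number
-- of biased coordinates.
charge : ∀ {r₁ r₀ ur c₁ c₀ uc bx by} → r₀ + ur ≡ 2 * r₁ → c₁ + uc ≡ 2 * c₀ →
  Balance r₁ r₀ ur bx → Balance c₀ c₁ uc by →
  r₁ * c₁ + r₀ * c₀ ≤ 3 * (ur * uc) + 4 * (bx * (r₁ * c₁) + by * (r₀ * c₀))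
charge {r₁} {r₀} {ur} {c₁} {c₀} {uc} r≡ c≡ (fair p _) (fair q _) = ≤-trans (fair-fair {r₁} {r₀} {ur} {c₁} {c₀} {uc} r≡ c≡ p q) (m≤m+n _ _)
charge {r₁} {r₀} {ur} {c₁} {c₀} {uc} r≡ c≡ (fair _ p) unfair = begin
  r₁ * c₁ + r₀ * c₀                ≤⟨ +-monoˡ-≤ (r₀ * c₀) (fair-unfair {r₁} {r₀} {ur} {c₁} {c₀} {uc} r≡ c≡ p) ⟩
  3 * (r₀ * c₀) + r₀ * c₀          ≡⟨ four (r₀ * c₀) ⟩
  4 * (1 * (r₀ * c₀))              ≤⟨ m≤n+m _ (3 * (ur * uc)) ⟩
  3 * (ur * uc) + 4 * (1 * (r₀ * c₀)) ∎
  where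
  open ≤-Reasoning
  four : ∀ a → 3 * a + a ≡ 4 * (1 * a)
  four = solve-∀
charge {r₁} {r₀} {ur} {c₁} {c₀} {uc} r≡ c≡ unfair (fair _ q) = begin
  r₁ * c₁ + r₀ * c₀                ≡⟨ cong (r₁ * c₁ +_) (*-comm r₀ c₀) ⟩
  r₁ * c₁ + c₀ * r₀                ≤⟨ +-monoʳ-≤ (r₁ * c₁) (fair-unfair {c₀} {c₁} {uc} {r₀} {r₁} {ur} c≡ r≡ q) ⟩
  r₁ * c₁ + 3 * (c₁ * r₁)          ≡⟨ four r₁ c₁ ⟩
  4 * (1 * (r₁ * c₁) + 0)          ≤⟨ m≤n+m _ (3 * (ur * uc)) ⟩
  3 * (ur * uc) + 4 * (1 * (r₁ * c₁) + 0) ∎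
  where
  open ≤-Reasoning
  four : ∀ a b → a * b + 3 * (b * a) ≡ 4 * (1 * (a * b) + 0)
  four = solve-∀
charge {r₁} {r₀} {ur} {c₁} {c₀} {uc} r≡ c≡ unfair unfair = begin
  r₁ * c₁ + r₀ * c₀                        ≤⟨ m≤n*m _ 4 ⟩
  4 * (r₁ * c₁ + r₀ * c₀)                  ≡⟨ cong (4 *_) (cong₂ _+_ (*-identityˡ (r₁ * c₁)) (*-identityˡ (r₀ * c₀))) ⟨
  4 * (1 * (r₁ * c₁) + 1 * (r₀ * c₀))      ≤⟨ m≤n+m _ (3 * (ur * uc)) ⟩
  3 * (ur * uc) + 4 * (1 * (r₁ * c₁) + 1 * (r₀ * c₀)) ∎
  where open ≤-Reasoning

module _ (f g : Vec Bool N → ℕ) where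

  cell : Vec Bool N → ℕ
  cell z = row f z * row g (¬ᵛ z)

  disjointMass : ℕ
  disjointMass = ∑ (cube N) cell

  -- The value does not depend on coordinate `i` of `z`. One crossing thus faces two cells, that
  -- where only `f` is free at `i` and that where only `g` is.
  crossing : Fin N → Vec Bool N → ℕ
  crossing i z = forced f i z * forced g i (¬ᵛ z)

  intersectingMass : ℕ
  intersectingMass = ∑[ i ∈ allFin N ] ∑ (cube N) (crossing i)

  charge-at : ∀ i z → cell (z [ i ]≔ false) + cell (z [ i ]≔ true) ≤
    3 * crossing i z + 4 * (biased f (z [ i ]≔ true) i * cell (z [ i ]≔ true) + biased g (¬ᵛ (z [ i ]≔ false)) i * cell (z [ i ]≔ false))
  charge-at i z rewrite ¬ᵛ-update i false z | ¬ᵛ-update i true z =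
    ≤-trans (≤-reflexive (+-comm (row f (z [ i ]≔ false) * row g ((¬ᵛ z) [ i ]≔ true)) _))
      (charge (average f i z) (average g i (¬ᵛ z)) (balance f i z) (balance g i (¬ᵛ z)))

  corruption-at : ∀ i → 2 * disjointMass ≤ 3 * ∑ (cube N) (crossing i) +
    8 * ((∑[ z ∈ cube N ] (biased f z i * cell z)) + (∑[ z ∈ cube N ] (biased g (¬ᵛ z) i * cell z)))
  corruption-at i = begin
    2 * disjointMass                                           ≡⟨ ∑-update i cell ⟨
    (∑[ z ∈ cube N ] cell (z [ i ]≔ false)) + (∑[ z ∈ cube N ] cell (z [ i ]≔ true))   ≡⟨ ∑-+ (cube N) _ _ ⟨
    (∑[ z ∈ cube N ] (cell (z [ i ]≔ false) + cell (z [ i ]≔ true)))   ≤⟨ ∑-mono (cube N) (charge-at i) ⟩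
    (∑[ z ∈ cube N ] (3 * crossing i z + 4 * (X (z [ i ]≔ true) + Y (z [ i ]≔ false))))  ≡⟨ ∑-+ (cube N) _ _ ⟩
    (∑[ z ∈ cube N ] (3 * crossing i z)) + (∑[ z ∈ cube N ] (4 * (X (z [ i ]≔ true) + Y (z [ i ]≔ false))))
      ≡⟨ cong₂ _+_ (∑-*ˡ (cube N) 3 (crossing i)) (trans (∑-*ˡ (cube N) 4 _) (cong (4 *_) (∑-+ (cube N) _ _))) ⟩
    3 * ∑ (cube N) (crossing i) + 4 * ((∑[ z ∈ cube N ] X (z [ i ]≔ true)) + (∑[ z ∈ cube N ] Y (z [ i ]≔ false)))
      -- A sum over one face is bounded by twice the sum over the cube, by dropping the opposite
      -- face.
      ≤⟨ +-monoʳ-≤ (3 * ∑ (cube N) (crossing i)) (*-monoʳ-≤ 4 (+-mono-≤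
           (m+n≤o⇒n≤o (∑[ z ∈ cube N ] X (z [ i ]≔ false)) (≤-reflexive (∑-update i X)))
           (m+n≤o⇒m≤o (∑[ z ∈ cube N ] Y (z [ i ]≔ false)) (≤-reflexive (∑-update i Y))))) ⟩
    3 * ∑ (cube N) (crossing i) + 4 * (2 * ∑ (cube N) X + 2 * ∑ (cube N) Y)
      ≡⟨ cong (3 * ∑ (cube N) (crossing i) +_) (eight (∑ (cube N) X) (∑ (cube N) Y)) ⟩
    3 * ∑ (cube N) (crossing i) + 8 * (∑ (cube N) X + ∑ (cube N) Y) ∎
    where
    open ≤-Reasoning
    X Y : Vec Bool N → ℕ
    X z = biased f z i * cell z
    Y z = biased g (¬ᵛ z) i * cell z
    eight : ∀ a b → 4 * (2 * a + 2 * b) ≡ 8 * (a + b)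
    eight = solve-∀

  private
    exchange : ∀ (β : Vec Bool N → Fin N → ℕ) →
      (∑[ i ∈ allFin N ] ∑[ z ∈ cube N ] (β z i * cell z)) ≡ (∑[ z ∈ cube N ] (∑ (allFin N) (β z) * cell z))
    exchange β = trans (∑-swap (allFin N) (cube N) _) (∑-cong (cube N) (λ z → ∑-*ʳ (allFin N) (cell z) (β z)))

  corruption-sum : N * (2 * disjointMass) ≤ 3 * intersectingMass +
    8 * ((∑[ z ∈ cube N ] (count (sign (slice f z)) * cell z)) + (∑[ z ∈ cube N ] (count (sign (slice g (¬ᵛ z))) * cell z)))
  corruption-sum = begin
    N * (2 * disjointMass)                       ≡⟨ cong (_* (2 * disjointMass)) (List.length-tabulate {n = N} id) ⟨
    length (allFin N) * (2 * disjointMass)       ≡⟨ ∑-const (allFin N) _ ⟨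
    (∑[ _ ∈ allFin N ] (2 * disjointMass))       ≤⟨ ∑-mono (allFin N) corruption-at ⟩
    (∑[ i ∈ allFin N ] (3 * ∑ (cube N) (crossing i) + 8 * (X i + Y i)))   ≡⟨ ∑-+ (allFin N) _ _ ⟩
    (∑[ i ∈ allFin N ] (3 * ∑ (cube N) (crossing i))) + (∑[ i ∈ allFin N ] (8 * (X i + Y i)))
      ≡⟨ cong₂ _+_ (∑-*ˡ (allFin N) 3 _) (trans (∑-*ˡ (allFin N) 8 _) (cong (8 *_) (∑-+ (allFin N) X Y))) ⟩
    3 * intersectingMass + 8 * (∑ (allFin N) X + ∑ (allFin N) Y)
      ≡⟨ cong₂ (λ x y → 3 * intersectingMass + 8 * (x + y)) (exchange (biased f)) (exchange (λ z → biased g (¬ᵛ z))) ⟩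
    3 * intersectingMass + 8 * ((∑[ z ∈ cube N ] (count (sign (slice f z)) * cell z)) + (∑[ z ∈ cube N ] (count (sign (slice g (¬ᵛ z))) * cell z))) ∎
    where
    open ≤-Reasoning
    X Y : Fin N → ℕ
    X i = ∑[ z ∈ cube N ] (biased f z i * cell z)
    Y i = ∑[ z ∈ cube N ] (biased g (¬ᵛ z) i * cell z)

  corruption : ∀ W → (∀ x → f x ≤ W) → (∀ y → g y ≤ W) → ∀ j →
    N * (2 * disjointMass) * 2 ^ j ≤
    3 * intersectingMass * 2 ^ j + 16 * (96 * j * 2 ^ j * disjointMass + 2 ^ N * (N * (W * 2 ^ N * (W * 2 ^ N))))
  corruption W f≤W g≤W j = begin
    N * (2 * disjointMass) * t                              ≤⟨ *-monoˡ-≤ t corruption-sum ⟩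
    (3 * intersectingMass + 8 * (∑ (cube N) X + ∑ (cube N) Y)) * t  ≡⟨ e₁ intersectingMass (∑ (cube N) X) (∑ (cube N) Y) t ⟩
    3 * intersectingMass * t + 8 * (∑ (cube N) X * t + ∑ (cube N) Y * t)
      ≡⟨ cong₂ (λ x y → 3 * intersectingMass * t + 8 * (x + y)) (∑-*ʳ (cube N) t X) (∑-*ʳ (cube N) t Y) ⟨
    3 * intersectingMass * t + 8 * ((∑[ z ∈ cube N ] (X z * t)) + (∑[ z ∈ cube N ] (Y z * t)))
      ≤⟨ +-monoʳ-≤ (3 * intersectingMass * t) (*-monoʳ-≤ 8 (+-mono-≤ (∑-mono (cube N) X≤) (∑-mono (cube N) Y≤))) ⟩
    3 * intersectingMass * t + 8 * ((∑[ z ∈ cube N ] (k * cell z + N * M²)) + (∑[ z ∈ cube N ] (k * cell z + N * M²)))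
      ≡⟨ cong (λ x → 3 * intersectingMass * t + 8 * (x + x)) (trans (∑-+ (cube N) _ _)
           (cong₂ _+_ (∑-*ˡ (cube N) k cell) (trans (∑-const (cube N) (N * M²)) (cong (_* (N * M²)) (length-cube N))))) ⟩
    3 * intersectingMass * t + 8 * ((k * disjointMass + 2 ^ N * (N * M²)) + (k * disjointMass + 2 ^ N * (N * M²)))
      ≡⟨ cong (3 * intersectingMass * t +_) (e₂ (k * disjointMass + 2 ^ N * (N * M²))) ⟩
    3 * intersectingMass * t + 16 * (k * disjointMass + 2 ^ N * (N * M²)) ∎
    where
    open ≤-Reasoning
    t k M² : ℕ
    t = 2 ^ j
    k = 96 * j * t
    M² = W * 2 ^ N * (W * 2 ^ N)
    X Y : Vec Bool N → ℕ
    X z = count (sign (slice f z)) * cell z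
    Y z = count (sign (slice g (¬ᵛ z))) * cell z
    X≤ : ∀ z → X z * t ≤ k * cell z + N * M²
    X≤ z = count-sign-* (slice f z) W (λ x → f≤W _) j (∑-cube-≤ (slice g (¬ᵛ z)) W (λ y → g≤W _))
    Y≤ : ∀ z → Y z * t ≤ k * cell z + N * M²
    Y≤ z = subst (λ c → count (sign (slice g (¬ᵛ z))) * c * t ≤ k * c + N * M²) (*-comm (row g (¬ᵛ z)) (row f z))
      (count-sign-* (slice g (¬ᵛ z)) W (λ y → g≤W _) j (∑-cube-≤ (slice f z) W (λ x → f≤W _)))
    e₁ : ∀ v x y t → (3 * v + 8 * (x + y)) * t ≡ 3 * v * t + 8 * (x * t + y * t)
    e₁ = solve-∀
    e₂ : ∀ a → 8 * (a + a) ≡ 16 * a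
    e₂ = solve-∀

-- Covering disjointness by rectangles

Disjoint : Vec Bool N → Vec Bool N → Set
Disjoint x y = ∀ i → lookup x i ∧ lookup y i ≡ false

Intersect : Vec Bool N → Vec Bool N → Set
Intersect x y = ∃[ i ] lookup x i ≡ true × lookup y i ≡ true

disjoint⇒¬intersect : ∀ (x y : Vec Bool N) → Disjoint x y → ¬ Intersect x y
disjoint⇒¬intersect x y disjoint (i , xi , yi) with () ← trans (sym (cong₂ _∧_ xi yi)) (disjoint i)

⊓ᵛ-disjoint : ∀ (x y z : Vec Bool N) → Disjoint (x ⊓ᵛ z) (y ⊓ᵛ ¬ᵛ z)
⊓ᵛ-disjoint (a ∷ x) (b ∷ y) (c ∷ z) zero    = contradictory a b c
  where
  contradictory : ∀ a b c → (a ∧ c) ∧ (b ∧ not c) ≡ false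
  contradictory false b     c     = refl
  contradictory true  false false = refl
  contradictory true  false true  = refl
  contradictory true  true  false = refl
  contradictory true  true  true  = refl
⊓ᵛ-disjoint (a ∷ x) (b ∷ y) (c ∷ z) (suc i) = ⊓ᵛ-disjoint x y z i

module _ {R : Set} (rs : List R) (f g : R → Vec Bool N → ℕ) (W : ℕ)
         (f≤W : ∀ r x → f r x ≤ W) (g≤W : ∀ r y → g r y ≤ W)
  where

  private
    entry : Vec Bool N → Vec Bool N → ℕ
    entry x y = ∑[ r ∈ rs ] (f r x * g r y)

    Z : ℕ
    Z = 2 ^ N * (2 ^ N * (2 ^ N * (W * W)))

    ∑³ : (Vec Bool N → Vec Bool N → Vec Bool N → ℕ) → ℕ
    ∑³ φ = ∑[ z ∈ cube N ] ∑[ x ∈ cube N ] ∑[ y ∈ cube N ] φ z x y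

    ∑-cube-const : ∀ k → (∑[ _ ∈ cube N ] k) ≡ 2 ^ N * k
    ∑-cube-const k = trans (∑-const (cube N) k) (cong (_* k) (length-cube N))

    ∑³-const : ∀ k → ∑³ (λ _ _ _ → k) ≡ 2 ^ N * (2 ^ N * (2 ^ N * k))
    ∑³-const k = trans (∑-cube-const _) (cong (2 ^ N *_) (trans (∑-cube-const _) (cong (2 ^ N *_) (∑-cube-const k))))

    ∑³-mono : ∀ {φ ψ} → (∀ z x y → φ z x y ≤ ψ z x y) → ∑³ φ ≤ ∑³ ψ
    ∑³-mono φ≤ψ = ∑-mono (cube N) (λ z → ∑-mono (cube N) (λ x → ∑-mono (cube N) (φ≤ψ z x)))

    ∑³-*ˡ : ∀ k φ → ∑³ (λ z x y → k * φ z x y) ≡ k * ∑³ φ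
    ∑³-*ˡ k φ = trans (∑-cong (cube N) (λ z → trans (∑-cong (cube N) (λ x → ∑-*ˡ (cube N) k (φ z x))) (∑-*ˡ (cube N) k _))) (∑-*ˡ (cube N) k _)

    -- Single rectangles carry no information about correctness; only their sum, an entry, does. The
    -- exchange turns total masses into sums of entries, to which `accepts` and `rejects` apply.
    gather : ∀ (u v : Vec Bool N → Vec Bool N → Vec Bool N) →
      (∑[ r ∈ rs ] ∑[ z ∈ cube N ] ((∑[ x ∈ cube N ] f r (u z x)) * (∑[ y ∈ cube N ] g r (v z y)))) ≡
      ∑³ (λ z x y → entry (u z x) (v z y))
    gather u v = trans (∑-swap rs (cube N) _) (∑-cong (cube N) (λ z →
      trans (∑-cong rs (λ r → sym (∑-∑-* (cube N) (cube N) (λ x → f r (u z x)) (λ y → g r (v z y)))))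
      (trans (∑-swap rs (cube N) _) (∑-cong (cube N) (λ x → ∑-swap rs (cube N) _)))))

  module _ (accepts : ∀ x y → Disjoint x y → 2 * (W * W) ≤ 3 * (∑[ r ∈ rs ] (f r x * g r y)))
           (rejects : ∀ x y → Intersect x y → 3 * (∑[ r ∈ rs ] (f r x * g r y)) ≤ W * W)
    where

    private
      U V : ℕ
      U = ∑[ r ∈ rs ] disjointMass (f r) (g r)
      V = ∑[ r ∈ rs ] intersectingMass (f r) (g r)

      U-large : 2 * Z ≤ 3 * U
      U-large = begin
        2 * Z                                                        ≡⟨ cong (2 *_) (∑³-const (W * W)) ⟨
        2 * ∑³ (λ _ _ _ → W * W)                                     ≡⟨ ∑³-*ˡ 2 (λ _ _ _ → W * W) ⟨
        ∑³ (λ _ _ _ → 2 * (W * W))                                   ≤⟨ ∑³-mono (λ z x y → accepts _ _ (⊓ᵛ-disjoint x y z)) ⟩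
        ∑³ (λ z x y → 3 * entry (x ⊓ᵛ z) (y ⊓ᵛ ¬ᵛ z))                ≡⟨ ∑³-*ˡ 3 (λ z x y → entry (x ⊓ᵛ z) (y ⊓ᵛ ¬ᵛ z)) ⟩
        3 * ∑³ (λ z x y → entry (x ⊓ᵛ z) (y ⊓ᵛ ¬ᵛ z))                ≡⟨ cong (3 *_) (gather (λ z x → x ⊓ᵛ z) (λ z y → y ⊓ᵛ ¬ᵛ z)) ⟨
        3 * U                                                        ∎
        where open ≤-Reasoning

      V-small : 3 * V ≤ N * Z
      V-small = begin
        3 * V
          ≡⟨ cong (3 *_) (∑-swap rs (allFin N) _) ⟩
        3 * (∑[ i ∈ allFin N ] ∑[ r ∈ rs ] ∑ (cube N) (crossing (f r) (g r) i))
          ≡⟨ cong (3 *_) (∑-cong (allFin N) (λ i → gather (λ z x → (x ⊓ᵛ z) [ i ]≔ true) (λ z y → (y ⊓ᵛ ¬ᵛ z) [ i ]≔ true))) ⟩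
        3 * (∑[ i ∈ allFin N ] at i)
          ≡⟨ ∑-*ˡ (allFin N) 3 at ⟨
        (∑[ i ∈ allFin N ] (3 * at i))
          ≤⟨ ∑-mono (allFin N) at-small ⟩
        (∑[ i ∈ allFin N ] Z)
          ≡⟨ trans (∑-const (allFin N) Z) (cong (_* Z) (List.length-tabulate {n = N} id)) ⟩
        N * Z ∎
        where
        open ≤-Reasoning
        at : Fin N → ℕ
        at i = ∑³ (λ z x y → entry ((x ⊓ᵛ z) [ i ]≔ true) ((y ⊓ᵛ ¬ᵛ z) [ i ]≔ true))
        at-small : ∀ i → 3 * at i ≤ Z
        at-small i = begin
          3 * at i      ≡⟨ ∑³-*ˡ 3 (λ z x y → entry ((x ⊓ᵛ z) [ i ]≔ true) ((y ⊓ᵛ ¬ᵛ z) [ i ]≔ true)) ⟨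
          ∑³ (λ z x y → 3 * entry ((x ⊓ᵛ z) [ i ]≔ true) ((y ⊓ᵛ ¬ᵛ z) [ i ]≔ true))
            ≤⟨ ∑³-mono (λ z x y → rejects _ _ (i , Vec.lookup∘updateAt i (x ⊓ᵛ z) , Vec.lookup∘updateAt i (y ⊓ᵛ ¬ᵛ z))) ⟩
          ∑³ (λ _ _ _ → W * W) ≡⟨ ∑³-const (W * W) ⟩
          Z ∎

      corruption-total : ∀ j → N * (2 * U) * 2 ^ j ≤
        3 * V * 2 ^ j + 16 * (96 * j * 2 ^ j * U + N * Z * length rs)
      corruption-total j = begin
        N * (2 * U) * t                                       ≡⟨ e₁ N U t ⟩
        2 * N * t * U                                         ≡⟨ ∑-*ˡ rs (2 * N * t) _ ⟨
        (∑[ r ∈ rs ] (2 * N * t * Uᵣ r))                      ≤⟨ ∑-mono rs at ⟩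
        (∑[ r ∈ rs ] (3 * t * Vᵣ r + (16 * (96 * j * t) * Uᵣ r + 16 * (N * Z)))) ≡⟨ ∑-+ rs _ _ ⟩
        (∑[ r ∈ rs ] (3 * t * Vᵣ r)) + (∑[ r ∈ rs ] (16 * (96 * j * t) * Uᵣ r + 16 * (N * Z)))
          ≡⟨ cong₂ _+_ (∑-*ˡ rs (3 * t) Vᵣ) (trans (∑-+ rs _ _) (cong₂ _+_ (∑-*ˡ rs (16 * (96 * j * t)) Uᵣ) (∑-const rs (16 * (N * Z))))) ⟩
        3 * t * V + (16 * (96 * j * t) * U + length rs * (16 * (N * Z)))   ≡⟨ e₂ t V (96 * j * t) U (length rs) (N * Z) ⟩
        3 * V * t + 16 * (96 * j * t * U + N * Z * length rs) ∎
        where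
        open ≤-Reasoning
        t = 2 ^ j
        Uᵣ Vᵣ : R → ℕ
        Uᵣ r = disjointMass (f r) (g r)
        Vᵣ r = intersectingMass (f r) (g r)
        e₁ : ∀ N U t → N * (2 * U) * t ≡ 2 * N * t * U
        e₁ = solve-∀
        e₂ : ∀ t V c U l z → 3 * t * V + (16 * c * U + l * (16 * z)) ≡ 3 * V * t + 16 * (c * U + z * l)
        e₂ = solve-∀
        e₃ : ∀ V t c U p N W → 3 * V * t + 16 * (c * U + p * (N * (W * p * (W * p)))) ≡ 3 * t * V + (16 * c * U + 16 * (N * (p * (p * (p * (W * W))))))
        e₃ = solve-∀
        at : ∀ r → 2 * N * t * Uᵣ r ≤ 3 * t * Vᵣ r + (16 * (96 * j * t) * Uᵣ r + 16 * (N * Z))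
        at r = begin
          2 * N * t * Uᵣ r        ≡⟨ e₁ N (Uᵣ r) t ⟨
          N * (2 * Uᵣ r) * t      ≤⟨ corruption (f r) (g r) W (f≤W r) (g≤W r) j ⟩
          3 * Vᵣ r * t + 16 * (96 * j * t * Uᵣ r + 2 ^ N * (N * (W * 2 ^ N * (W * 2 ^ N)))) ≡⟨ e₃ (Vᵣ r) t (96 * j * t) (Uᵣ r) (2 ^ N) N W ⟩
          3 * t * Vᵣ r + (16 * (96 * j * t) * Uᵣ r + 16 * (N * Z)) ∎

    -- In units of `N * Z`, the product `N * U` is at least 2/3 and `3 * V` at most 1. By the
    -- hypothesis on `j` the biased coordinates cost at most a quarter of `N * U`, as 64 = 4 · 16,
    -- and 7/4 · 2/3 = 7/6 remains. So the error 16 · 2^-j · `length rs` is at least 1/6, whence the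
    -- factor 96 = 6 · 16.
    disjointness : .{{_ : NonZero N}} .{{_ : NonZero W}} → ∀ j → 64 * (96 * j) ≤ N → 2 ^ j ≤ 96 * length rs
    disjointness j j-small = *-cancelˡ-≤ (2 * (N * Z)) {{nz}} (+-cancelˡ-≤ (12 * (N * Z * t)) _ _ (begin
      12 * (N * Z * t) + 2 * (N * Z) * t                 ≡⟨ e₁ N Z t ⟩
      7 * N * t * (2 * Z)                                ≤⟨ *-monoʳ-≤ (7 * N * t) U-large ⟩
      7 * N * t * (3 * U)                                ≡⟨ e₂ N t U ⟩
      3 * (7 * (N * U * t))                              ≤⟨ *-monoʳ-≤ 3 seven ⟩
      3 * (4 * (3 * V) * t + 64 * (N * Z * length rs))   ≤⟨ *-monoʳ-≤ 3 (+-monoˡ-≤ (64 * (N * Z * length rs)) (*-monoˡ-≤ t (*-monoʳ-≤ 4 V-small))) ⟩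
      3 * (4 * (N * Z) * t + 64 * (N * Z * length rs))   ≡⟨ e₃ (N * Z) t (length rs) ⟩
      12 * (N * Z * t) + 2 * (N * Z) * (96 * length rs)  ∎))
      where
      open ≤-Reasoning
      t = 2 ^ j
      scaled : ∀ {k} → NonZero k → NonZero (2 ^ N * k)
      scaled {k} k≢0 = m*n≢0 (2 ^ N) k {{m^n≢0 2 N}} {{k≢0}}
      nz : NonZero (2 * (N * Z))
      nz = m*n≢0 2 (N * Z) {{_}} {{m*n≢0 N Z {{it}} {{scaled (scaled (scaled (m*n≢0 W W)))}}}}
      e₁ : ∀ N Z t → 12 * (N * Z * t) + 2 * (N * Z) * t ≡ 7 * N * t * (2 * Z)
      e₁ = solve-∀
      e₂ : ∀ N t U → 7 * N * t * (3 * U) ≡ 3 * (7 * (N * U * t))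
      e₂ = solve-∀
      e₃ : ∀ n t l → 3 * (4 * n * t + 64 * (n * l)) ≡ 12 * (n * t) + 2 * n * (96 * l)
      e₃ = solve-∀
      e₄ : ∀ N U t → N * U * t + 7 * (N * U * t) ≡ 4 * (N * (2 * U) * t)
      e₄ = solve-∀
      e₅ : ∀ V t j U z → 4 * (3 * V * t + 16 * (96 * j * t * U + z)) ≡ 64 * (96 * j) * (U * t) + (4 * (3 * V) * t + 64 * z)
      e₅ = solve-∀
      seven : 7 * (N * U * t) ≤ 4 * (3 * V) * t + 64 * (N * Z * length rs)
      seven = +-cancelˡ-≤ (N * U * t) _ _ (begin
        N * U * t + 7 * (N * U * t)            ≡⟨ e₄ N U t ⟩
        4 * (N * (2 * U) * t)                  ≤⟨ *-monoʳ-≤ 4 (corruption-total j) ⟩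
        4 * (3 * V * t + 16 * (96 * j * t * U + N * Z * length rs))  ≡⟨ e₅ V t j U (N * Z * length rs) ⟩
        64 * (96 * j) * (U * t) + (4 * (3 * V) * t + 64 * (N * Z * length rs))  ≤⟨ +-monoˡ-≤ _ (*-monoˡ-≤ (U * t) j-small) ⟩
        N * (U * t) + (4 * (3 * V) * t + 64 * (N * Z * length rs))  ≡⟨ cong (_+ (4 * (3 * V) * t + 64 * (N * Z * length rs))) (*-assoc N U t) ⟨
        N * U * t + (4 * (3 * V) * t + 64 * (N * Z * length rs))  ∎)

-- Two-party protocols

transcripts : {M₁ M₂ : Set} → List M₁ → List M₂ → ∀ T → List (Vec (M₁ × M₂) T)
transcripts ms₁ ms₂ = words (cartesianProduct ms₁ ms₂)

length-transcripts : ∀ {M₁ M₂ : Set} (ms₁ : List M₁) (ms₂ : List M₂) T →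
                     length (transcripts ms₁ ms₂ T) ≡ (length ms₁ * length ms₂) ^ T
length-transcripts ms₁ ms₂ T = trans (length-words _ T) (cong (_^ T) (length-cartesian _,_ ms₁ ms₂))

module Party {S M M′ : Set} (_≟′_ : DecidableEquality M)
             (say : S → M) (hear : S → M′ → S) (accept : S → Bool) where

  -- The messages of the other player are read off the transcript, so only the state of this player
  -- enters. That is what makes each transcript a rectangle.
  consistent : ∀ {T} → Vec (M × M′) T → S → ℕ
  consistent []            s = 𝟙 (accept s)
  consistent ((a , b) ∷ τ) s = 𝟙 (does (say s ≟′ a)) * consistent τ (hear s b)

  consistent≤1 : ∀ {T} (τ : Vec (M × M′) T) s → consistent τ s ≤ 1
  consistent≤1 []            s = 𝟙≤1 (accept s)
  consistent≤1 ((a , b) ∷ τ) s = *-mono-≤ (𝟙≤1 (does (say s ≟′ a))) (consistent≤1 τ (hear s b))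

module TwoParty
  {S₁ S₂ M₁ M₂ : Set} {_≟₁_ : DecidableEquality M₁} {_≟₂_ : DecidableEquality M₂}
  {ms₁ : List M₁} {ms₂ : List M₂} (enum₁ : Enumerates _≟₁_ ms₁) (enum₂ : Enumerates _≟₂_ ms₂)
  (say₁ : S₁ → M₁) (say₂ : S₂ → M₂) (hear₁ : S₁ → M₂ → S₁) (hear₂ : S₂ → M₁ → S₂)
  (accept₁ : S₁ → Bool) (accept₂ : S₂ → Bool)
  where

  accept : ℕ → S₁ → S₂ → Bool
  accept zero    s₁ s₂ = accept₁ s₁ ∧ accept₂ s₂
  accept (suc T) s₁ s₂ = accept T (hear₁ s₁ (say₂ s₂)) (hear₂ s₂ (say₁ s₁))

  open Party _≟₁_ say₁ hear₁ accept₁ using () renaming (consistent to consistent₁)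
  open Party _≟₂_ say₂ hear₂ accept₂ using () renaming (consistent to consistent₂)

  private
    agreement : ∀ {T} → Vec (M₁ × M₂) T → S₁ → S₂ → ℕ
    agreement τ s₁ s₂ = consistent₁ τ s₁ * consistent₂ (Vec.map swap τ) s₂

  -- From a given pair of states exactly one transcript is spoken, so every other term vanishes.
  -- `Enumerates` introduces the sums over the two messages of a round.
  accept-rectangles : ∀ T s₁ s₂ →
    𝟙 (accept T s₁ s₂) ≡ (∑[ τ ∈ transcripts ms₁ ms₂ T ] (consistent₁ τ s₁ * consistent₂ (Vec.map swap τ) s₂))
  accept-rectangles zero    s₁ s₂ = trans (𝟙-∧ (accept₁ s₁) (accept₂ s₂)) (sym (+-identityʳ _))
  accept-rectangles (suc T) s₁ s₂ = begin
    𝟙 (accept T (hear₁ s₁ (say₂ s₂)) (hear₂ s₂ (say₁ s₁)))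
      ≡⟨ accept-rectangles T _ _ ⟩
    rest (say₁ s₁) (say₂ s₂)
      ≡⟨ enum₂ (say₂ s₂) (rest (say₁ s₁)) ⟨
    (∑[ b ∈ ms₂ ] (𝟙 (does (say₂ s₂ ≟₂ b)) * rest (say₁ s₁) b))
      ≡⟨ enum₁ (say₁ s₁) (λ a → ∑[ b ∈ ms₂ ] (𝟙 (does (say₂ s₂ ≟₂ b)) * rest a b)) ⟨
    (∑[ a ∈ ms₁ ] (𝟙 (does (say₁ s₁ ≟₁ a)) * (∑[ b ∈ ms₂ ] (𝟙 (does (say₂ s₂ ≟₂ b)) * rest a b))))
      ≡⟨ ∑-cong ms₁ (λ a → trans (sym (∑-*ˡ ms₂ (𝟙 (does (say₁ s₁ ≟₁ a))) _)) (∑-cong ms₂ (push a))) ⟩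
    (∑[ a ∈ ms₁ ] ∑[ b ∈ ms₂ ] ∑[ τ ∈ transcripts ms₁ ms₂ T ] agreement ((a , b) ∷ τ) s₁ s₂)
      ≡⟨ ∑-cartesian _,_ ms₁ ms₂ _ ⟨
    (∑[ ab ∈ cartesianProduct ms₁ ms₂ ] ∑[ τ ∈ transcripts ms₁ ms₂ T ] agreement (ab ∷ τ) s₁ s₂)
      ≡⟨ ∑-words-suc (cartesianProduct ms₁ ms₂) T _ ⟨
    (∑[ τ ∈ transcripts ms₁ ms₂ (suc T) ] agreement τ s₁ s₂) ∎
    where
    open ≡-Reasoning
    rest : M₁ → M₂ → ℕ
    rest a b = ∑[ τ ∈ transcripts ms₁ ms₂ T ] agreement τ (hear₁ s₁ b) (hear₂ s₂ a)
    interchange : ∀ p q c d → p * (q * (c * d)) ≡ p * c * (q * d)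
    interchange = solve-∀
    push : ∀ a b → 𝟙 (does (say₁ s₁ ≟₁ a)) * (𝟙 (does (say₂ s₂ ≟₂ b)) * rest a b) ≡
      (∑[ τ ∈ transcripts ms₁ ms₂ T ] agreement ((a , b) ∷ τ) s₁ s₂)
    push a b = begin
      p * (q * rest a b)   ≡⟨ cong (p *_) (∑-*ˡ (transcripts ms₁ ms₂ T) q _) ⟨
      p * (∑[ τ ∈ transcripts ms₁ ms₂ T ] (q * agreement τ (hear₁ s₁ b) (hear₂ s₂ a)))  ≡⟨ ∑-*ˡ (transcripts ms₁ ms₂ T) p _ ⟨
      (∑[ τ ∈ transcripts ms₁ ms₂ T ] (p * (q * agreement τ (hear₁ s₁ b) (hear₂ s₂ a))))
        ≡⟨ ∑-cong (transcripts ms₁ ms₂ T) (λ τ → interchange p q (consistent₁ τ (hear₁ s₁ b)) (consistent₂ (Vec.map swap τ) (hear₂ s₂ a))) ⟩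
      (∑[ τ ∈ transcripts ms₁ ms₂ T ] agreement ((a , b) ∷ τ) s₁ s₂) ∎
      where
      p = 𝟙 (does (say₁ s₁ ≟₁ a))
      q = 𝟙 (does (say₂ s₂ ≟₂ b))

-- Simulating a network across a cut

widen : ∀ {b} → Message b → Message (suc b)
widen (bounded w w≤b) = bounded w (m≤n⇒m≤1+n w≤b)

-- A message is stored behind its leading 1; the zero word stands for silence.
decode : ∀ {b} → Vec Bool (suc b) → Maybe (Message b)
decode         (true  ∷ w)  = just (bounded w ≤-refl)
decode {zero}  (false ∷ []) = nothing
decode {suc b} (false ∷ w)  = Maybe.map widen (decode w)

-- There are 2^(b + 1) - 1 messages besides silence, just as many as nonzero words; a short message
-- is padded by leading zeros.
decode-surjective : ∀ b (m : Maybe (Message b)) → ∃[ w ] decode w ≡ m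
decode-surjective zero    nothing = (false ∷ []) , refl
decode-surjective (suc b) nothing with w , eq ← decode-surjective b nothing =
  (false ∷ w) , cong (Maybe.map widen) eq
decode-surjective b (just (bounded v v≤b)) = pad b v v≤b
  where
  pad : ∀ b {l} (v : Vec Bool l) .(l≤b : l ≤ b) → ∃[ w ] decode w ≡ just (bounded v l≤b)
  pad b {l} v l≤b with l ≟ b
  ... | yes refl = (true ∷ v) , refl
  pad zero    []      l≤b | no l≢b = ⊥-elim (l≢b refl)
  pad zero    (_ ∷ _) ()  | no l≢b
  pad (suc b) v       l≤b | no l≢b with w , eq ← pad b v (s≤s⁻¹ (≤∧≢⇒< l≤b l≢b)) =
    (false ∷ w) , cong (Maybe.map widen) eq

encode : ∀ {b} → Maybe (Message b) → Vec Bool (suc b)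
encode m = proj₁ (decode-surjective _ m)

decode-encode : ∀ {b} (m : Maybe (Message b)) → decode (encode m) ≡ m
decode-encode m = proj₂ (decode-surjective _ m)

Say : ℕ → ℕ → Set
Say C b = Vec (Vec Bool (suc b)) C

module _ (C b : ℕ) where

  say-≟ : DecidableEquality (Say C b)
  say-≟ = Vec.≡-dec (Vec.≡-dec Bool._≟_)

  says : List (Say C b)
  says = words (words bools (suc b)) C

  says-enumerate : Enumerates say-≟ says
  says-enumerate = words-enumerate {xs = words bools (suc b)} (words-enumerate {xs = bools} bools-enumerate (suc b)) C

  length-says : length says ≡ 2 ^ (suc b * C)
  length-says = trans (length-words (words bools (suc b)) C)
    (trans (cong (_^ C) (length-words bools (suc b))) (^-*-assoc 2 (suc b) C))

module Network {n b : ℕ} (P : Protocol n b) where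
  open Protocol P

  Config : Set
  Config = Fin n → State

  -- `emit` and `absorb` belong to a module over the graph, which neither player knows in full.
  -- These counterparts mention the protocol alone.
  emitted : State → Fin n → Maybe (Message b)
  emitted s v = Maybe.maybe′ (λ _ → nothing) (send s v) (output s)

  absorbed : State → Vec (Maybe (Message b)) n → State
  absorbed s inbox = Maybe.maybe′ (λ _ → s) (receive s inbox) (output s)

  module _ (G : Digraph n) where
    open Digraph G
    open Execution P G

    emit≡ : ∀ s v → emit s v ≡ emitted s v
    emit≡ s v with output s
    ... | nothing = refl
    ... | just _  = refl

    absorb≡ : ∀ s inbox → absorb s inbox ≡ absorbed s inbox
    absorb≡ s inbox with output s
    ... | nothing = refl
    ... | just _  = refl

    round≡ : ∀ σ v → round σ v ≡ absorbed (σ v) (tabulate λ u → if linked u v then emitted (σ u) v else nothing)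
    round≡ σ v = trans (absorb≡ _ _) (cong (absorbed (σ v)) (Vec.tabulate-cong λ u →
      cong (λ m → if linked u v then m else nothing) (emit≡ (σ u) v)))

    -- Unlike `stateAfter`, this adds a round at the front, following the recursion of
    -- `TwoParty.accept`.
    rounds : ℕ → Config → Config
    rounds zero    σ = σ
    rounds (suc t) σ = rounds t (round σ)

    rounds-suc : ∀ t σ → rounds (suc t) σ ≡ round (rounds t σ)
    rounds-suc zero    σ = refl
    rounds-suc (suc t) σ = rounds-suc t (round σ)

    initial : (Fin n → Fin seeds) → Config
    initial ρ v = init (viewAt G v) (ρ v)

    stateAfter≡ : ∀ t ω → stateAfter t ω ≡ rounds t (initial (finToFun ω))
    stateAfter≡ zero    ω = refl
    stateAfter≡ (suc t) ω = trans (cong round (stateAfter≡ t ω)) (sym (rounds-suc t _))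

  reports? : ∀ (s : State) → Dec (output s ≡ just true)
  reports? s = Maybe.≡-dec Bool._≟_ (output s) (just true)

  silent : Config → Bool
  silent σ = does (¬? (Fin.any? λ v → reports? (σ v)))

  accepting : Digraph n → ℕ → ℕ
  accepting G T = length (filter (λ ω → ¬? (reportedAfter? T ω)) (allFin (seeds ^ n)))
    where open Execution P G

  accepting≡ : ∀ G T → accepting G T ≡ (∑[ ω ∈ allFin (seeds ^ n) ] 𝟙 (silent (rounds G T (initial G (finToFun ω)))))
  accepting≡ G T = trans (length-filter-∑ (λ ω → ¬? (reportedAfter? T ω)) (allFin (seeds ^ n)))
    (∑-cong (allFin (seeds ^ n)) (λ ω → cong (𝟙 ∘ silent) (stateAfter≡ G T ω)))
    where open Execution P G

  -- The nodes owned by one player, who knows H; the states of the other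
  -- nodes are simulated as well but are meaningless.
  module Player {C : ℕ} (own : Fin n → Bool) (near far : Fin C → Fin n) (H : Digraph n) where

    say : Config → Say C b
    say σ = tabulate λ c → encode (emitted (σ (near c)) (far c))

    crossing? : ∀ u v → Dec (∃[ c ] far c ≡ u × near c ≡ v)
    crossing? u v = Fin.any? λ c → (far c Fin.≟ u) ×-dec (near c Fin.≟ v)

    incoming : Say C b → Fin n → Fin n → Maybe (Message b)
    incoming m u v with crossing? u v
    -- Whichever link is found, its message is determined by the two endpoints.
    ... | yes (c , _) = decode (lookup m c)
    ... | no  _       = nothing

    hear : Config → Say C b → Config
    hear σ m v = absorbed (σ v) (tabulate λ u →
      if Digraph.linked H u v then (if own u then emitted (σ u) v else incoming m u v) else nothing)

    accept : Config → Bool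
    accept σ = does (¬? (Fin.any? λ v → (own v Bool.≟ true) ×-dec reports? (σ v)))

    open Party (say-≟ C b) say hear accept public

    mass : ∀ {T} → Vec (Say C b × Say C b) T → ℕ
    mass τ = ∑[ ρ ∈ words (allFin seeds) n ] consistent τ (initial H (lookup ρ))

    mass≤ : ∀ {T} (τ : Vec (Say C b × Say C b) T) → mass τ ≤ seeds ^ n
    mass≤ τ = begin
      mass τ                                    ≤⟨ ∑-mono (words (allFin seeds) n) (λ ρ → consistent≤1 τ (initial H (lookup ρ))) ⟩
      (∑[ _ ∈ words (allFin seeds) n ] 1)       ≡⟨ length-∑ (words (allFin seeds) n) ⟩
      length (words (allFin seeds) n)           ≡⟨ length-words (allFin seeds) n ⟩
      length (allFin seeds) ^ n                 ≡⟨ cong (_^ n) (List.length-tabulate {n = seeds} id) ⟩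
      seeds ^ n                                 ∎
      where open ≤-Reasoning

  -- p marks the nodes of the first player, who knows G₁; the second knows G₂.
  module Cut {C : ℕ} (p : Fin n → Bool) (α β : Fin C → Fin n)
             (pα : ∀ c → p (α c) ≡ true) (pβ : ∀ c → p (β c) ≡ false)
             (G G₁ G₂ : Digraph n)
             (G≡G₁ : ∀ u v → p u ≡ true ⊎ p v ≡ true → Digraph.edge G u v ≡ Digraph.edge G₁ u v)
             (G≡G₂ : ∀ u v → p u ≡ false ⊎ p v ≡ false → Digraph.edge G u v ≡ Digraph.edge G₂ u v)
             (cut : ∀ u v → p u ≡ true → p v ≡ false → Digraph.linked G u v ≡ true → ∃[ c ] α c ≡ u × β c ≡ v)
             where

    Agrees : (Fin n → Bool) → Config → Config → Set
    Agrees own σ₁ σ = ∀ v → own v ≡ true → σ₁ v ≡ σ v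

    -- One statement serves both players, `own` being `p` or its complement. At an owned node `H`
    -- shows the true links; a neighbour that is owned is simulated correctly, and any other is
    -- reached across the cut, so that its message has just been said.
    hear-round : ∀ (own : Fin n → Bool) (near far : Fin C → Fin n) (H : Digraph n) →
      (∀ c → own (far c) ≡ false) →
      (∀ u v → own v ≡ true → Digraph.linked G u v ≡ Digraph.linked H u v) →
      (∀ u v → own u ≡ false → own v ≡ true → Digraph.linked G u v ≡ true → ∃[ c ] far c ≡ u × near c ≡ v) →
      ∀ {σ₁ σ₂ σ} → Agrees own σ₁ σ → Agrees (not ∘ own) σ₂ σ →
      Agrees own (Player.hear own near far H σ₁ (Player.say (not ∘ own) far near G σ₂)) (Execution.round P G σ)
    hear-round own near far H far-foreign link covered {σ₁} {σ₂} {σ} agree₁ agree₂ v v-own =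
      sym (trans (round≡ G σ v) (cong₂ absorbed (sym (agree₁ v v-own)) (Vec.tabulate-cong message)))
      where
      open Player own near far H
      m : Say C b
      m = Player.say (not ∘ own) far near G σ₂
      heard : ∀ u → own u ≡ false → Digraph.linked G u v ≡ true → emitted (σ u) v ≡ incoming m u v
      heard u u-foreign u∼v with crossing? u v
      ... | no  none              = ⊥-elim (none (covered u v u-foreign v-own u∼v))
      ... | yes (c , refl , refl) = sym (trans (cong decode (Vec.lookup∘tabulate _ c))
        (trans (decode-encode _) (cong (λ s → emitted s (near c)) (agree₂ (far c) (cong not u-foreign)))))
      message : ∀ u → (if Digraph.linked G u v then emitted (σ u) v else nothing) ≡
        (if Digraph.linked H u v then (if own u then emitted (σ₁ u) v else incoming m u v) else nothing)
      message u with Digraph.linked G u v in eq | link u v v-own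
      ... | false | eq′ rewrite sym eq′ = refl
      ... | true  | eq′ rewrite sym eq′ with own u in own-u
      ...   | true  = cong (λ s → emitted s v) (sym (agree₁ u own-u))
      ...   | false = heard u own-u eq

    private
      module First  = Player p α β G₁
      module Second = Player (not ∘ p) β α G₂

    open TwoParty {_≟₁_ = say-≟ C b} {say-≟ C b} {says C b} {says C b} (says-enumerate C b) (says-enumerate C b)
      First.say Second.say First.hear Second.hear First.accept Second.accept

    silent-∧ : ∀ {σ₁ σ₂ σ} → Agrees p σ₁ σ → Agrees (not ∘ p) σ₂ σ → silent σ ≡ First.accept σ₁ ∧ Second.accept σ₂
    silent-∧ {σ₁} {σ₂} {σ} agree₁ agree₂ =
      does-⇔ (mk⇔ to from) (¬? (Fin.any? λ v → reports? (σ v)))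
        (¬? (Fin.any? λ v → (p v Bool.≟ true) ×-dec reports? (σ₁ v)) ×-dec
         ¬? (Fin.any? λ v → (not (p v) Bool.≟ true) ×-dec reports? (σ₂ v)))
      where
      Reported : Config → Fin n → Set
      Reported σ v = output (σ v) ≡ just true
      to : ¬ (∃[ v ] Reported σ v) →
           ¬ (∃[ v ] p v ≡ true × Reported σ₁ v) × ¬ (∃[ v ] not (p v) ≡ true × Reported σ₂ v)
      to none = (λ (v , own , r) → none (v , trans (cong output (sym (agree₁ v own))) r)) ,
                (λ (v , own , r) → none (v , trans (cong output (sym (agree₂ v own))) r))
      from : ¬ (∃[ v ] p v ≡ true × Reported σ₁ v) × ¬ (∃[ v ] not (p v) ≡ true × Reported σ₂ v) →
             ¬ (∃[ v ] Reported σ v)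
      from (none₁ , none₂) (v , r) with p v in eq
      ... | true  = none₁ (v , eq , trans (cong output (agree₁ v eq)) r)
      ... | false = none₂ (v , cong not eq , trans (cong output (agree₂ v (cong not eq))) r)

    private
      linked≡₁ : ∀ u v → p v ≡ true → Digraph.linked G u v ≡ Digraph.linked G₁ u v
      linked≡₁ u v pv = cong₂ _∨_ (G≡G₁ u v (inj₂ pv)) (G≡G₁ v u (inj₁ pv))

      linked≡₂ : ∀ u v → not (p v) ≡ true → Digraph.linked G u v ≡ Digraph.linked G₂ u v
      linked≡₂ u v pv = cong₂ _∨_ (G≡G₂ u v (inj₂ (Bool.not-injective pv))) (G≡G₂ v u (inj₁ (Bool.not-injective pv)))

      covered₁ : ∀ u v → p u ≡ false → p v ≡ true → Digraph.linked G u v ≡ true → ∃[ c ] β c ≡ u × α c ≡ v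
      covered₁ u v pu pv u∼v
        with c , αc , βc ← cut v u pv pu (trans (Bool.∨-comm (Digraph.edge G v u) _) u∼v) = c , βc , αc

      covered₂ : ∀ u v → not (p u) ≡ false → not (p v) ≡ true → Digraph.linked G u v ≡ true → ∃[ c ] α c ≡ u × β c ≡ v
      covered₂ u v pu pv = cut u v (Bool.not-injective pu) (Bool.not-injective pv)

      not-not : ∀ {σ₁ σ} → Agrees p σ₁ σ → Agrees (not ∘ not ∘ p) σ₁ σ
      not-not agree v v-own = agree v (trans (sym (Bool.not-involutive (p v))) v-own)

    simulate : ∀ T {σ₁ σ₂ σ} → Agrees p σ₁ σ → Agrees (not ∘ p) σ₂ σ → silent (rounds G T σ) ≡ accept T σ₁ σ₂
    simulate zero    agree₁ agree₂ = silent-∧ agree₁ agree₂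
    simulate (suc T) agree₁ agree₂ = simulate T
      (hear-round p α β G₁ pβ linked≡₁ covered₁ agree₁ agree₂)
      (hear-round (not ∘ p) β α G₂ (λ c → cong not (pα c)) linked≡₂ covered₂ agree₂ (not-not agree₁))

    initial-agrees₁ : ∀ {ρ₁ ρ} → (∀ v → p v ≡ true → ρ₁ v ≡ ρ v) → Agrees p (initial G₁ ρ₁) (initial G ρ)
    initial-agrees₁ ρ≡ v pv = cong₂ init
      (cong₂ (localView v) (Vec.tabulate-cong λ u → sym (G≡G₁ v u (inj₁ pv))) (Vec.tabulate-cong λ u → sym (G≡G₁ u v (inj₂ pv))))
      (ρ≡ v pv)

    initial-agrees₂ : ∀ {ρ₂ ρ} → (∀ v → not (p v) ≡ true → ρ₂ v ≡ ρ v) → Agrees (not ∘ p) (initial G₂ ρ₂) (initial G ρ)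
    initial-agrees₂ ρ≡ v npv = cong₂ init
      (cong₂ (localView v) (Vec.tabulate-cong λ u → sym (G≡G₂ v u (inj₁ pv))) (Vec.tabulate-cong λ u → sym (G≡G₂ u v (inj₂ pv))))
      (ρ≡ v npv)
      where pv = Bool.not-injective npv

    private
      verdict : (Fin n → Fin seeds) → ℕ → ℕ
      verdict ρ T = 𝟙 (silent (rounds G T (initial G ρ)))

      verdict-rectangles : ∀ T {ρ₁ ρ₂ ρ} → (∀ v → p v ≡ true → ρ₁ v ≡ ρ v) → (∀ v → not (p v) ≡ true → ρ₂ v ≡ ρ v) →
        verdict ρ T ≡ (∑[ τ ∈ transcripts (says C b) (says C b) T ]
          (First.consistent τ (initial G₁ ρ₁) * Second.consistent (Vec.map swap τ) (initial G₂ ρ₂)))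
      verdict-rectangles T ρ₁≡ ρ₂≡ =
        trans (cong 𝟙 (simulate T (initial-agrees₁ ρ₁≡) (initial-agrees₂ ρ₂≡))) (accept-rectangles T _ _)

      -- In the absence of function extensionality this is not a plain congruence. The simulation
      -- only compares seeds pointwise, so both verdicts equal the rectangle sum for players that
      -- hold `ρ`.
      verdict-cong : ∀ T {ρ ρ′} → (∀ v → ρ v ≡ ρ′ v) → verdict ρ T ≡ verdict ρ′ T
      verdict-cong T {ρ} {ρ′} ρ≡ρ′ =
        trans (verdict-rectangles T {ρ} {ρ} (λ _ _ → refl) (λ _ _ → refl))
          (sym (verdict-rectangles T {ρ} {ρ} {ρ′} (λ v _ → ρ≡ρ′ v) (λ v _ → ρ≡ρ′ v)))

    -- Giving each player a full seed vector multiplies the count by `seeds ^ n`. The two vectors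
    -- are then summed over independently, and each rectangle factors.
    accepting-rectangles : ∀ T → seeds ^ n * accepting G T ≡
      (∑[ τ ∈ transcripts (says C b) (says C b) T ] (First.mass τ * Second.mass (Vec.map swap τ)))
    accepting-rectangles T = begin
      seeds ^ n * accepting G T
        ≡⟨ cong (seeds ^ n *_) (trans (accepting≡ G T) (∑-finToFun seeds n (λ ρ → verdict ρ T) (verdict-cong T))) ⟩
      seeds ^ n * (∑[ ρ ∈ ρs ] verdict (lookup ρ) T)
        ≡⟨ cong (λ k → k ^ n * (∑[ ρ ∈ ρs ] verdict (lookup ρ) T)) (List.length-tabulate {n = seeds} id) ⟨
      length (allFin seeds) ^ n * (∑[ ρ ∈ ρs ] verdict (lookup ρ) T)
        ≡⟨ ∑-mix (allFin seeds) n p (λ ρ → verdict (lookup ρ) T) ⟨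
      (∑[ ρ₁ ∈ ρs ] ∑[ ρ₂ ∈ ρs ] verdict (lookup (mix p ρ₁ ρ₂)) T)
        ≡⟨ ∑-cong ρs (λ ρ₁ → ∑-cong ρs (λ ρ₂ → verdict-rectangles T (left ρ₁ ρ₂) (right ρ₁ ρ₂))) ⟩
      (∑[ ρ₁ ∈ ρs ] ∑[ ρ₂ ∈ ρs ] ∑[ τ ∈ τs ] (f τ ρ₁ * g τ ρ₂))
        ≡⟨ ∑-cong ρs (λ ρ₁ → ∑-swap ρs τs _) ⟩
      (∑[ ρ₁ ∈ ρs ] ∑[ τ ∈ τs ] ∑[ ρ₂ ∈ ρs ] (f τ ρ₁ * g τ ρ₂))
        ≡⟨ ∑-swap ρs τs _ ⟩
      (∑[ τ ∈ τs ] ∑[ ρ₁ ∈ ρs ] ∑[ ρ₂ ∈ ρs ] (f τ ρ₁ * g τ ρ₂))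
        ≡⟨ ∑-cong τs (λ τ → ∑-∑-* ρs ρs (f τ) (g τ)) ⟩
      (∑[ τ ∈ τs ] (First.mass τ * Second.mass (Vec.map swap τ))) ∎
      where
      open ≡-Reasoning
      ρs = words (allFin seeds) n
      τs = transcripts (says C b) (says C b) T
      f g : Vec (Say C b × Say C b) T → Vec (Fin seeds) n → ℕ
      f τ ρ = First.consistent τ (initial G₁ (lookup ρ))
      g τ ρ = Second.consistent (Vec.map swap τ) (initial G₂ (lookup ρ))
      left : ∀ ρ₁ ρ₂ v → p v ≡ true → lookup ρ₁ v ≡ lookup (mix p ρ₁ ρ₂) v
      left ρ₁ ρ₂ v pv = sym (trans (lookup-mix p ρ₁ ρ₂ v) (cong (λ c → if c then lookup ρ₁ v else lookup ρ₂ v) pv))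
      right : ∀ ρ₁ ρ₂ v → not (p v) ≡ true → lookup ρ₂ v ≡ lookup (mix p ρ₁ ρ₂) v
      right ρ₁ ρ₂ v npv = sym (trans (lookup-mix p ρ₁ ρ₂ v) (cong (λ c → if c then lookup ρ₁ v else lookup ρ₂ v) (Bool.not-injective npv)))

-- The layered graph

module _ {q-1 : ℕ} where
  private
    q = suc q-1

  toℕ-mod : ∀ m → toℕ (m mod q) ≡ m % q
  toℕ-mod m = Fin.toℕ-fromℕ< (m%n<n m q)

  mod-≡ : ∀ m n → m % q ≡ n % q → m mod q ≡ n mod q
  mod-≡ m n eq = Fin.toℕ-injective (trans (toℕ-mod m) (trans eq (sym (toℕ-mod n))))

  toℕ-mod-id : ∀ (a : Fin q) → toℕ a mod q ≡ a
  toℕ-mod-id a = Fin.toℕ-injective (trans (toℕ-mod (toℕ a)) (m<n⇒m%n≡m (Fin.toℕ<n a)))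

  cyclicSuc-mod : ∀ m → cyclicSuc (m mod q) ≡ suc m mod q
  cyclicSuc-mod m = mod-≡ (suc (toℕ (m mod q))) (suc m) (begin
    suc (toℕ (m mod q)) % q      ≡⟨ cong (λ k → suc k % q) (toℕ-mod m) ⟩
    suc (m % q) % q              ≡⟨ %-distribˡ-+ 1 (m % q) q ⟩
    (1 % q + m % q % q) % q      ≡⟨ cong (λ k → (1 % q + k) % q) (m%n%n≡m%n m q) ⟩
    (1 % q + m % q) % q          ≡⟨ %-distribˡ-+ 1 m q ⟨
    suc m % q                    ∎)
    where open ≡-Reasoning

  toℕ-cyclicSuc : ∀ (l : Fin q) → toℕ (cyclicSuc l) ≡ suc (toℕ l) ⊎ (toℕ l ≡ q-1 × cyclicSuc l ≡ zero)
  toℕ-cyclicSuc l with suc (toℕ l) <? q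
  ... | yes l<q = inj₁ (trans (toℕ-mod (suc (toℕ l))) (m<n⇒m%n≡m l<q))
  ... | no  l≮q = inj₂ (l≡ , Fin.toℕ-injective (trans (toℕ-mod (suc (toℕ l))) (trans (cong (λ k → suc k % q) l≡) (n%n≡0 q))))
    where
    l≡ : toℕ l ≡ q-1
    l≡ = ≤-antisym (s≤s⁻¹ (Fin.toℕ<n l)) (s≤s⁻¹ (≮⇒≥ l≮q))

-- The vertices (l , i) form q = 4 + p layers of size k; the other r vertices are isolated.
module Layered (p k r : ℕ) where

  q n : ℕ
  q = 4 + p
  n = q * k + r

  Place : Set
  Place = Maybe (Fin q × Fin k)

  place : Fin n → Place
  place u = [ just ∘ remQuot k , (λ _ → nothing) ]′ (splitAt (q * k) u)

  vertex : Fin q → Fin k → Fin n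
  vertex l i = combine l i ↑ˡ r

  place-vertex : ∀ l i → place (vertex l i) ≡ just (l , i)
  place-vertex l i rewrite Fin.splitAt-↑ˡ (q * k) (combine l i) r = cong just (Fin.remQuot-combine l i)

  vertex-place : ∀ u {l i} → place u ≡ just (l , i) → vertex l i ≡ u
  vertex-place u eq with splitAt (q * k) u in split
  vertex-place u refl | inj₁ w = trans (cong (_↑ˡ r) (Fin.combine-remQuot {q} k w)) (Fin.splitAt⁻¹-↑ˡ split)

  Bits : Set
  Bits = Vec Bool (k * k)

  -- Layers 0 to 1 spell out `x` and layers 2 to 3 the transpose of `y`; all other steps copy the
  -- index. A walk once around the layers thus reads i, j, j, i and closes up exactly at a common
  -- coordinate (i, j).
  allowed : Bits → Bits → Fin q → Fin k → Fin k → Bool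
  allowed x y zero             i j = lookup x (combine i j)
  allowed x y (suc (suc zero)) i j = lookup y (combine j i)
  allowed x y _                i j = does (i Fin.≟ j)

  arc : Bits → Bits → Place → Place → Bool
  arc x y (just (l , i)) (just (m , j)) = does (m Fin.≟ cyclicSuc l) ∧ allowed x y l i j
  arc x y _              _              = false

  arc-loopless : ∀ x y a → arc x y a a ≡ false
  arc-loopless x y nothing        = refl
  arc-loopless x y (just (l , i)) = cong (_∧ allowed x y l i i) (dec-false (l Fin.≟ cyclicSuc l) l≢)
    where
    l≢ : l ≢ cyclicSuc l
    l≢ l≡ with toℕ-cyclicSuc l
    ... | inj₁ eq          = 1+n≢n (trans (sym eq) (cong toℕ (sym l≡)))
    ... | inj₂ (last , eq) with () ← trans (sym last) (cong toℕ (trans l≡ eq))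

  graph : Bits → Bits → Digraph n
  graph x y = record
    { edge     = λ u v → arc x y (place u) (place v)
    ; loopless = λ v → arc-loopless x y (place v)
    }

  module _ (x y : Bits) where

    arc-step : ∀ {l i m j} → arc x y (just (l , i)) (just (m , j)) ≡ true →
               m ≡ cyclicSuc l × allowed x y l i j ≡ true
    arc-step {l} {m = m} eq with m Fin.≟ cyclicSuc l
    ... | yes m≡ = m≡ , eq

    arc-true : ∀ a b → arc x y a b ≡ true →
      ∃[ l ] ∃[ i ] ∃[ j ] a ≡ just (l , i) × b ≡ just (cyclicSuc l , j) × allowed x y l i j ≡ true
    arc-true (just (l , i)) (just (m , j)) eq with refl , ok ← arc-step {l} {i} {m} {j} eq = l , i , j , refl , refl , ok

    copy-≡ : ∀ {i j : Fin k} → does (i Fin.≟ j) ≡ true → i ≡ j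
    copy-≡ {i} {j} eq with i Fin.≟ j
    ... | yes i≡j = i≡j

    allowed-copy : ∀ l {i j} → 3 ≤ toℕ l → allowed x y l i j ≡ true → i ≡ j
    allowed-copy zero                ()                  _
    allowed-copy (suc zero)          (s≤s ())            _
    allowed-copy (suc (suc zero))    (s≤s (s≤s ()))      _
    allowed-copy (suc (suc (suc _))) _                   eq = copy-≡ eq

    intersect⇒cycle : Intersect x y → HasCycle q (graph x y)
    intersect⇒cycle (w , xw , yw) = (λ l → vertex l (pos l)) , injective , edges
      where
      i j : Fin k
      i = proj₁ (remQuot k w)
      j = proj₂ (remQuot {k} k w)
      ij : combine i j ≡ w
      ij = Fin.combine-remQuot {k} k w
      pos : Fin q → Fin k
      pos (suc zero)       = j
      pos (suc (suc zero)) = j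
      pos _                = i
      injective : ∀ {l m} → vertex l (pos l) ≡ vertex m (pos m) → l ≡ m
      injective {l} {m} eq = cong proj₁ (Maybe.just-injective
        (trans (sym (place-vertex l (pos l))) (trans (cong place eq) (place-vertex m (pos m)))))
      pos-late : ∀ m → 4 ≤ toℕ m ⊎ m ≡ zero → pos m ≡ i
      pos-late zero                _                          = refl
      pos-late (suc zero)          (inj₁ (s≤s ()))
      pos-late (suc (suc zero))    (inj₁ (s≤s (s≤s ())))
      pos-late (suc (suc (suc _))) _                          = refl
      late : ∀ (l : Fin (suc p)) → 4 ≤ toℕ (cyclicSuc (suc (suc (suc l)))) ⊎ cyclicSuc {q} (suc (suc (suc l))) ≡ zero
      late l with toℕ-cyclicSuc {3 + p} (suc (suc (suc l)))
      ... | inj₁ eq       = inj₁ (subst (4 ≤_) (sym eq) (s≤s (s≤s (s≤s (s≤s z≤n)))))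
      ... | inj₂ (_ , eq) = inj₂ eq
      step : ∀ l → allowed x y l (pos l) (pos (cyclicSuc l)) ≡ true
      step zero                = trans (cong (lookup x) ij) xw
      step (suc zero)          = dec-true (j Fin.≟ j) refl
      step (suc (suc zero))    = trans (cong (lookup y) ij) yw
      step (suc (suc (suc l))) = dec-true (i Fin.≟ _) (sym (pos-late _ (late l)))
      edges : ∀ l → arc x y (place (vertex l (pos l))) (place (vertex (cyclicSuc l) (pos (cyclicSuc l)))) ≡ true
      edges l = trans (cong₂ (arc x y) (place-vertex l (pos l)) (place-vertex (cyclicSuc l) (pos (cyclicSuc l))))
        (cong₂ _∧_ (dec-true (cyclicSuc l Fin.≟ cyclicSuc l) refl) (step l))

    -- Every arc advances the layer by one modulo q, so the q arcs meet every layer once and the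
    -- cycle can be indexed by layers. Copying gives `P 1 ≡ P 2`, and from layer 3 around to layer 0
    -- it gives `P 3 ≡ P 0`; the arcs out of layers 0 and 2 then use the same coordinate.
    cycle⇒intersect : HasCycle q (graph x y) → Intersect x y
    cycle⇒intersect (c , _ , edges) = combine i j , xij , yij
      where
      open ≡-Reasoning
      located : ∀ l → ∃[ m ] ∃[ i ] place (c l) ≡ just (m , i)
      located l with m , i , _ , eq , _ ← arc-true _ _ (edges l) = m , i , eq
      layer : Fin q → Fin q
      layer l = proj₁ (located l)
      pos : Fin q → Fin k
      pos l = proj₁ (proj₂ (located l))
      at : ∀ l → place (c l) ≡ just (layer l , pos l)
      at l = proj₂ (proj₂ (located l))
      step : ∀ l → layer (cyclicSuc l) ≡ cyclicSuc (layer l) × allowed x y (layer l) (pos l) (pos (cyclicSuc l)) ≡ true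
      step l = arc-step {layer l} {pos l} {layer (cyclicSuc l)} {pos (cyclicSuc l)} (trans (sym (cong₂ (arc x y) (at l) (at (cyclicSuc l)))) (edges l))
      a = toℕ (layer (0 mod q))
      layer-mod : ∀ m → layer (m mod q) ≡ (m + a) mod q
      layer-mod zero    = sym (toℕ-mod-id (layer (0 mod q)))
      layer-mod (suc m) = begin
        layer (suc m mod q)             ≡⟨ cong layer (cyclicSuc-mod m) ⟨
        layer (cyclicSuc (m mod q))     ≡⟨ proj₁ (step (m mod q)) ⟩
        cyclicSuc (layer (m mod q))     ≡⟨ cong cyclicSuc (layer-mod m) ⟩
        cyclicSuc ((m + a) mod q)       ≡⟨ cyclicSuc-mod (m + a) ⟩
        suc (m + a) mod q               ∎
      -- The cycle visits layer e at index m₀ + e.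
      m₀ = q ∸ a
      layer-m₀ : ∀ e → layer ((e + m₀) mod q) ≡ e mod q
      layer-m₀ e = trans (layer-mod (e + m₀)) (mod-≡ (e + m₀ + a) e (begin
        (e + m₀ + a) % q   ≡⟨ cong (_% q) (trans (+-assoc e m₀ a) (cong (e +_) (m∸n+n≡m (<⇒≤ (Fin.toℕ<n (layer (0 mod q))))))) ⟩
        (e + q) % q        ≡⟨ [m+n]%n≡m%n e q ⟩
        e % q              ∎))
      P : ℕ → Fin k
      P e = pos ((e + m₀) mod q)
      move : ∀ e → allowed x y (e mod q) (P e) (P (suc e)) ≡ true
      move e = begin
        allowed x y (e mod q) (P e) (P (suc e))
          ≡⟨ cong₂ (λ l m → allowed x y l (P e) (pos m)) (layer-m₀ e) (cyclicSuc-mod (e + m₀)) ⟨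
        allowed x y (layer ((e + m₀) mod q)) (P e) (pos (cyclicSuc ((e + m₀) mod q)))
          ≡⟨ proj₂ (step ((e + m₀) mod q)) ⟩
        true ∎
      stay : ∀ d → 3 + d ≤ q → P 3 ≡ P (3 + d)
      stay zero    _  = refl
      stay (suc d) d< = trans (stay d (<⇒≤ d<′)) (subst (λ e → P (3 + d) ≡ P e) (sym (+-suc 3 d))
        (allowed-copy ((3 + d) mod q) {P (3 + d)} {P (4 + d)} (subst (3 ≤_) (sym (trans (toℕ-mod (3 + d)) (m<n⇒m%n≡m d<′))) (m≤m+n 3 d)) (move (3 + d))))
        where
        d<′ : 3 + d < q
        d<′ = subst (_≤ q) (+-suc 3 d) d<
      wrap : P q ≡ P 0
      wrap = cong pos (mod-≡ (q + m₀) m₀ (trans (cong (_% q) (+-comm q m₀)) ([m+n]%n≡m%n m₀ q)))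
      i j : Fin k
      i = P 0
      j = P 1
      xij : lookup x (combine i j) ≡ true
      xij = move 0
      1-2 : P 1 ≡ P 2
      1-2 = copy-≡ {P 1} {P 2} (move 1)
      yij : lookup y (combine i j) ≡ true
      yij = subst₂ (λ u v → lookup y (combine u v) ≡ true) (trans (stay (suc p) ≤-refl) wrap) (sym 1-2) (move 2)

  first : Place → Bool
  first (just (zero     , _)) = true
  first (just (suc zero , _)) = true
  first _                     = false

  first-late : ∀ l {i} → 2 ≤ toℕ l → first (just (l , i)) ≡ false
  first-late zero          ()
  first-late (suc zero)    (s≤s ())
  first-late (suc (suc l)) _        = refl

  -- `y` is read only on arcs from layer 2 to layer 3, both owned by the second player. The wrong
  -- successors of layer 2 are ruled out by computation, `q` being literally `4 + p`.
  arc-first : ∀ x y y′ a b → first a ≡ true ⊎ first b ≡ true → arc x y a b ≡ arc x y′ a b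
  arc-first x y y′ nothing                             b       _  = refl
  arc-first x y y′ (just _)                            nothing _  = refl
  arc-first x y y′ (just (zero , i))                   (just (m , j)) _ = refl
  arc-first x y y′ (just (suc zero , i))               (just (m , j)) _ = refl
  arc-first x y y′ (just (suc (suc (suc l)) , i))      (just (m , j)) _ = refl
  arc-first x y y′ (just (suc (suc zero) , i))         (just (zero , j)) _ = refl
  arc-first x y y′ (just (suc (suc zero) , i))         (just (suc zero , j)) _ = refl
  arc-first x y y′ (just (suc (suc zero) , i))         (just (suc (suc m) , j)) (inj₁ ())
  arc-first x y y′ (just (suc (suc zero) , i))         (just (suc (suc m) , j)) (inj₂ ())

  arc-second : ∀ x x′ y a b → first a ≡ false ⊎ first b ≡ false → arc x y a b ≡ arc x′ y a b
  arc-second x x′ y nothing                        b       _  = refl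
  arc-second x x′ y (just _)                       nothing _  = refl
  arc-second x x′ y (just (suc zero , i))          (just (m , j)) _ = refl
  arc-second x x′ y (just (suc (suc zero) , i))    (just (m , j)) _ = refl
  arc-second x x′ y (just (suc (suc (suc l)) , i)) (just (m , j)) _ = refl
  arc-second x x′ y (just (zero , i))              (just (zero , j)) _ = refl
  arc-second x x′ y (just (zero , i))              (just (suc zero , j)) (inj₁ ())
  arc-second x x′ y (just (zero , i))              (just (suc zero , j)) (inj₂ ())
  arc-second x x′ y (just (zero , i))              (just (suc (suc m) , j)) _ = refl

  side : Fin n → Bool
  side u = first (place u)

  last : Fin q
  last = fromℕ (3 + p)

  -- The first `k` links join the last layer to layer 0, the others layer 1 to layer 2. `α` is the
  -- endpoint of the first player, whichever way the arc points.
  α β : Fin (k + k) → Fin n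
  α c = [ vertex zero , vertex (suc zero) ]′ (splitAt k c)
  β c = [ vertex last , vertex (suc (suc zero)) ]′ (splitAt k c)

  side-α : ∀ c → side (α c) ≡ true
  side-α c with splitAt k c
  ... | inj₁ i = cong first (place-vertex zero i)
  ... | inj₂ j = cong first (place-vertex (suc zero) j)

  side-β : ∀ c → side (β c) ≡ false
  side-β c with splitAt k c
  ... | inj₁ i = cong first (place-vertex last i)
  ... | inj₂ j = cong first (place-vertex (suc (suc zero)) j)

  cut : ∀ x y u v → side u ≡ true → side v ≡ false → Digraph.linked (graph x y) u v ≡ true →
        ∃[ c ] α c ≡ u × β c ≡ v
  cut x y u v su sv u∼v with arc x y (place u) (place v) in uv
  ... | true with arc-true x y (place u) (place v) uv
  ...   | zero , i , j , _ , pv , _ with () ← trans (sym sv) (cong first pv)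
  ...   | suc zero , i , j , pu , pv , ok with refl ← copy-≡ x y {i} {j} ok =
    k ↑ʳ i ,
    trans (cong [ vertex zero , vertex (suc zero) ]′ (Fin.splitAt-↑ʳ k k i)) (vertex-place u pu) ,
    trans (cong [ vertex last , vertex (suc (suc zero)) ]′ (Fin.splitAt-↑ʳ k k i)) (vertex-place v pv)
  ...   | suc (suc l) , i , j , pu , _ , _ with () ← trans (sym su) (cong first pu)
  cut x y u v su sv u∼v | false with arc-true x y (place v) (place u) u∼v
  ...   | zero , i , j , pv , _ , _ with () ← trans (sym sv) (cong first pv)
  ...   | suc zero , i , j , pv , _ , _ with () ← trans (sym sv) (cong first pv)
  ...   | suc (suc l) , i , j , pv , pu , ok with toℕ-cyclicSuc {3 + p} (suc (suc l))
  ...     | inj₁ eq 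
    with () ← trans (sym (first-late (cyclicSuc (suc (suc l))) (subst (2 ≤_) (sym eq) (s≤s (s≤s z≤n))))) (trans (sym (cong first pu)) su)
  ...     | inj₂ (l≡ , eq) with refl ← allowed-copy x y (suc (suc l)) {i} {j} (subst (3 ≤_) (sym l≡) (m≤m+n 3 p)) ok =
    i ↑ˡ k ,
    trans (cong [ vertex zero , vertex (suc zero) ]′ (Fin.splitAt-↑ˡ k i k)) (vertex-place u (trans pu (cong (λ m → just (m , i)) eq))) ,
    trans (cong [ vertex last , vertex (suc (suc zero)) ]′ (Fin.splitAt-↑ˡ k i k))
      (vertex-place v (trans pv (cong (λ m → just (m , i)) (Fin.toℕ-injective (trans l≡ (sym (Fin.toℕ-fromℕ (3 + p))))))))

-- The lower bound

length-filter-¬ : ∀ {A : Set} {P : Pred A 0ℓ} (P? : Decidable P) xs →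
  length (filter P? xs) + length (filter (λ x → ¬? (P? x)) xs) ≡ length xs
length-filter-¬ P? xs = begin
  length (filter P? xs) + length (filter (λ x → ¬? (P? x)) xs)
    ≡⟨ cong₂ _+_ (length-filter-∑ P? xs) (length-filter-∑ (λ x → ¬? (P? x)) xs) ⟩
  (∑[ x ∈ xs ] 𝟙 (does (P? x))) + (∑[ x ∈ xs ] 𝟙 (not (does (P? x))))
    ≡⟨ ∑-+ xs _ _ ⟨
  (∑[ x ∈ xs ] (𝟙 (does (P? x)) + 𝟙 (not (does (P? x)))))
    ≡⟨ ∑-cong xs (λ x → one (does (P? x))) ⟩
  (∑[ _ ∈ xs ] 1)
    ≡⟨ length-∑ xs ⟩
  length xs ∎
  where
  open ≡-Reasoning
  one : ∀ b → 𝟙 b + 𝟙 (not b) ≡ 1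
  one false = refl
  one true  = refl

2^-cancel-≤ : ∀ m n → 2 ^ m ≤ 2 ^ n → m ≤ n
2^-cancel-≤ m n 2^m≤2^n = ≮⇒≥ λ n<m → <⇒≱ (^-monoʳ-< 2 (s≤s (s≤s z≤n)) n<m) 2^m≤2^n

module _ (p k r : ℕ) {b : ℕ} (T : ℕ) (P : Protocol ((4 + p) * k + r) b) where
  open Layered p k r
  open Network P
  open Protocol P

  private
    W : ℕ
    W = seeds ^ n

    reporting : Digraph n → ℕ
    reporting G = length (filter (Execution.reportedAfter? P G T) (allFin W))

    reporting+accepting : ∀ G → reporting G + accepting G T ≡ W
    reporting+accepting G =
      trans (length-filter-¬ (Execution.reportedAfter? P G T) (allFin W)) (List.length-tabulate {n = W} id)

    none : Bits
    none = Vec.replicate (k * k) false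

    τs : List (Vec (Say (k + k) b × Say (k + k) b) T)
    τs = transcripts (says (k + k) b) (says (k + k) b) T

    -- Each player puts the empty set for the unknown input. The actual graph differs from this
    -- guess only in arcs with neither end among the player's own vertices.
    f g : Vec (Say (k + k) b × Say (k + k) b) T → Bits → ℕ
    f τ x = Player.mass side α β (graph x none) τ
    g τ y = Player.mass (not ∘ side) β α (graph none y) (Vec.map swap τ)

    rectangles : ∀ x y → W * accepting (graph x y) T ≡ (∑[ τ ∈ τs ] (f τ x * g τ y))
    rectangles x y = Cut.accepting-rectangles side α β side-α side-β (graph x y) (graph x none) (graph none y)
      (λ u v → arc-first x y none (place u) (place v)) (λ u v → arc-second x none y (place u) (place v)) (cut x y) T

    2^-transcripts : length τs ≡ 2 ^ ((suc b * (k + k) + suc b * (k + k)) * T)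
    2^-transcripts = begin
      length τs                                     ≡⟨ length-transcripts (says (k + k) b) (says (k + k) b) T ⟩
      (length (says (k + k) b) * length (says (k + k) b)) ^ T  ≡⟨ cong (λ l → (l * l) ^ T) (length-says (k + k) b) ⟩
      (2 ^ c * 2 ^ c) ^ T                           ≡⟨ cong (_^ T) (^-distribˡ-+-* 2 c c) ⟨
      (2 ^ (c + c)) ^ T                             ≡⟨ ^-*-assoc 2 (c + c) T ⟩
      2 ^ ((c + c) * T)                             ∎
      where
      open ≡-Reasoning
      c = suc b * (k + k)

  Detects : Set
  Detects = ∀ (G : Digraph n) → let open Execution P G in
      (HasCycle q G   → Probability≥⅔ (reportedAfter? T))
    × (¬ HasCycle q G → Probability≥⅔ (λ ω → ¬? (reportedAfter? T ω)))

  module _ (detects : Detects) where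

    disjoint⇒silent : ∀ x y → Disjoint x y → 2 * (W * W) ≤ 3 * (∑[ τ ∈ τs ] (f τ x * g τ y))
    disjoint⇒silent x y disjoint = begin
      2 * (W * W)                           ≡⟨ *-exchange 2 W W ⟩
      W * (2 * W)                           ≤⟨ *-monoʳ-≤ W (proj₂ (detects (graph x y)) no-cycle) ⟩
      W * (3 * accepting (graph x y) T)     ≡⟨ *-exchange W 3 (accepting (graph x y) T) ⟩
      3 * (W * accepting (graph x y) T)     ≡⟨ cong (3 *_) (rectangles x y) ⟩
      3 * (∑[ τ ∈ τs ] (f τ x * g τ y))     ∎
      where
      open ≤-Reasoning
      no-cycle : ¬ HasCycle q (graph x y)
      no-cycle = disjoint⇒¬intersect x y disjoint ∘ cycle⇒intersect x y

    intersect⇒loud : ∀ x y → Intersect x y → 3 * (∑[ τ ∈ τs ] (f τ x * g τ y)) ≤ W * W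
    intersect⇒loud x y intersect = begin
      3 * (∑[ τ ∈ τs ] (f τ x * g τ y))     ≡⟨ cong (3 *_) (rectangles x y) ⟨
      3 * (W * accepting G T)               ≡⟨ *-exchange 3 W (accepting G T) ⟩
      W * (3 * accepting G T)               ≤⟨ *-monoʳ-≤ W few ⟩
      W * W                                 ∎
      where
      open ≤-Reasoning
      G = graph x y
      three : ∀ a b → 3 * a + 3 * b ≡ 2 * (a + b) + (a + b)
      three = solve-∀
      few : 3 * accepting G T ≤ W
      few = +-cancelˡ-≤ (2 * W) _ _ (begin
        2 * W + 3 * accepting G T             ≤⟨ +-monoˡ-≤ (3 * accepting G T) (proj₁ (detects G) (intersect⇒cycle x y intersect)) ⟩
        3 * reporting G + 3 * accepting G T   ≡⟨ three (reporting G) (accepting G T) ⟩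
        2 * (reporting G + accepting G T) + (reporting G + accepting G T) ≡⟨ cong (λ w → 2 * w + w) (reporting+accepting G) ⟩
        2 * W + W                             ∎)

    -- The exponent counts bits: in each of `T` rounds both players send `suc b` bits over each of
    -- `k + k` links. The 7 is log₂ 96 rounded up.
    rounds-bound : .{{_ : NonZero k}} → ∀ j → 64 * (96 * j) ≤ k * k →
                   j ≤ 7 + (suc b * (k + k) + suc b * (k + k)) * T
    rounds-bound j j-small = 2^-cancel-≤ j (7 + e) (begin
      2 ^ j               ≤⟨ disjointness τs f g W (λ τ x → Player.mass≤ side α β (graph x none) τ)
                               (λ τ y → Player.mass≤ (not ∘ side) β α (graph none y) (Vec.map swap τ))
                               disjoint⇒silent intersect⇒loud {{m*n≢0 k k}} {{m^n≢0 seeds n}} j j-small ⟩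
      96 * length τs      ≡⟨ cong (96 *_) 2^-transcripts ⟩
      96 * 2 ^ e          ≤⟨ *-monoˡ-≤ (2 ^ e) (≤ᵇ⇒≤ 96 (2 ^ 7) _) ⟩
      2 ^ 7 * 2 ^ e       ≡⟨ ^-distribˡ-+-* 2 7 e ⟨
      2 ^ (7 + e)         ∎)
      where
      open ≤-Reasoning
      e = (suc b * (k + k) + suc b * (k + k)) * T

-- Takes j = ⌊k² / D⌋ in the hypothesis; the additive constants are absorbed since k ≥ 16 D.
side-bound : ∀ D .{{_ : NonZero D}} k a → D * 16 ≤ k →
  (∀ j → D * j ≤ k * k → j ≤ 7 + (a * (k + k) + a * (k + k))) → k ≤ D * 8 * a
side-bound D k a k-large bound = *-cancelˡ-≤ k {{k≢0}} (+-cancelˡ-≤ (k * k) _ _ (begin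
  k * k + k * k                      ≤⟨ +-mono-≤ k²≤ k²≤ ⟩
  D * (8 + e) + D * (8 + e)          ≡⟨ regroup D k a ⟩
  D * 16 + k * (D * 8 * a)           ≤⟨ +-monoˡ-≤ _ (≤-trans k-large (m≤m*n k k {{k≢0}})) ⟩
  k * k + k * (D * 8 * a)            ∎))
  where
  open ≤-Reasoning
  k≢0 : NonZero k
  k≢0 = >-nonZero (≤-trans (>-nonZero⁻¹ (D * 16) {{m*n≢0 D 16}}) k-large)
  j = k * k / D
  e = a * (k + k) + a * (k + k)
  k²≤ : k * k ≤ D * (8 + e)
  k²≤ = begin
    k * k                    ≡⟨ m≡m%n+[m/n]*n (k * k) D ⟩
    k * k % D + j * D        ≤⟨ +-monoˡ-≤ (j * D) (<⇒≤ (m%n<n (k * k) D)) ⟩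
    (1 + j) * D              ≡⟨ *-comm (1 + j) D ⟩
    D * (1 + j)              ≤⟨ *-monoʳ-≤ D (s≤s (bound j (≤-trans (≤-reflexive (*-comm D j)) (m/n*n≤m (k * k) D)))) ⟩
    D * (8 + e)              ∎
  regroup : ∀ D k a → D * (8 + (a * (k + k) + a * (k + k))) + D * (8 + (a * (k + k) + a * (k + k))) ≡ D * 16 + k * (D * 8 * a)
  regroup = solve-∀

-- The hypothesis keeps `n` a variable tied to `Q * k + r` by an equation; matching it with `refl`
-- places the protocol for `n` vertices on the layered graph.
rounds-Ω : ∀ D .{{_ : NonZero D}} Q .{{_ : NonZero Q}} (b T : ℕ → ℕ) → O[log-n] b →
  (∀ n k r → n ≡ Q * k + r → NonZero k → ∀ j → D * j ≤ k * k → j ≤ 7 + (suc (b n) * (k + k) + suc (b n) * (k + k)) * T n) →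
  Ω[n/log-n] T
-- From `n ≥ D * 16 * Q` follows `n / Q ≥ D * 16`, which `side-bound` demands; `n ≥ 2` makes the
-- logarithm at least 1, so that it absorbs the extra bit in `suc (b n)`.
rounds-Ω D Q b T (c , N , b≤) rounds = D * 16 * Q * suc c , N ⊔ D * 16 * Q ⊔ 2 , λ n n-large →
  bound n (m⊔n≤o⇒m≤o N _ (m⊔n≤o⇒m≤o (N ⊔ D * 16 * Q) 2 n-large))
          (m⊔n≤o⇒n≤o N _ (m⊔n≤o⇒m≤o (N ⊔ D * 16 * Q) 2 n-large))
          (m⊔n≤o⇒n≤o (N ⊔ D * 16 * Q) 2 n-large)
  where
  open ≤-Reasoning
  bound : ∀ n → N ≤ n → D * 16 * Q ≤ n → 2 ≤ n → n ≤ D * 16 * Q * suc c * (T n * ⌈log₂ n ⌉)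
  bound n N≤n n-large 2≤n = begin
    n                                              ≡⟨ n≡ ⟩
    -- The remainder is below `Q`, hence below `Q * k`: the isolated vertices at most double `n`.
    Q * k + r                                      ≤⟨ +-monoʳ-≤ (Q * k) (≤-trans (<⇒≤ (m%n<n n Q)) (m≤m*n Q k {{k≢0}})) ⟩
    Q * k + Q * k                                  ≡⟨ *-distribˡ-+ Q k k ⟨
    Q * (k + k)                                    ≤⟨ *-monoʳ-≤ Q (+-mono-≤ k≤ k≤) ⟩
    Q * (D * 8 * (suc (b n) * T n) + D * 8 * (suc (b n) * T n))  ≡⟨ e₁ D Q (suc (b n)) (T n) ⟩
    D * 16 * Q * (suc (b n) * T n)                 ≤⟨ *-monoʳ-≤ (D * 16 * Q) (*-monoˡ-≤ (T n) (+-mono-≤ (⌈log₂⌉-mono-≤ 2≤n) (b≤ n N≤n))) ⟩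
    D * 16 * Q * (suc c * ⌈log₂ n ⌉ * T n)         ≡⟨ e₂ (D * 16 * Q) (suc c) ⌈log₂ n ⌉ (T n) ⟩
    D * 16 * Q * suc c * (T n * ⌈log₂ n ⌉)         ∎
    where
    k = n / Q
    r = n % Q
    n≡ : n ≡ Q * k + r
    n≡ = trans (m≡m%n+[m/n]*n n Q) (trans (+-comm r (k * Q)) (cong (_+ r) (*-comm k Q)))
    k-large : D * 16 ≤ k
    k-large = ≤-trans (≤-reflexive (sym (m*n/n≡m (D * 16) Q))) (/-monoˡ-≤ Q n-large)
    k≢0 : NonZero k
    k≢0 = >-nonZero (≤-trans (>-nonZero⁻¹ (D * 16) {{m*n≢0 D 16}}) k-large)
    e₃ : ∀ b k t → (b * (k + k) + b * (k + k)) * t ≡ b * t * (k + k) + b * t * (k + k)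
    e₃ = solve-∀
    k≤ : k ≤ D * 8 * (suc (b n) * T n)
    k≤ = side-bound D k (suc (b n) * T n) k-large (λ j j-small →
      ≤-trans (rounds n k r n≡ k≢0 j j-small) (≤-reflexive (cong (7 +_) (e₃ (suc (b n)) k (T n)))))
    e₁ : ∀ D Q b t → Q * (D * 8 * (b * t) + D * 8 * (b * t)) ≡ D * 16 * Q * (b * t)
    e₁ = solve-∀
    e₂ : ∀ K c l t → K * (c * l * t) ≡ K * c * (t * l)
    e₂ = solve-∀

theorem4 : (q : ℕ) → 4 ≤ q →
    (A : Algorithm) (T : ℕ → ℕ) →
    RunsWithin T A → DetectsCycles q T A → Ω[n/log-n] T
theorem4 q 4≤q A T _ detects with p , refl ← m≤n⇒∃[o]m+o≡n 4≤q =
  -- Here 96 is the number of biased coordinates that halves the density, and 64 keeps their cost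
  -- within the gap left by error 1/3.
  rounds-Ω (64 * 96) (4 + p) (Algorithm.bandwidth A) T (Algorithm.bandwidth-log A)
    (λ { n k r refl k≢0 j j-small → rounds-bound p k r (T n) (Algorithm.protocol A n) (detects n) {{k≢0}} j
           (≤-trans (≤-reflexive (sym (*-assoc 64 96 j))) j-small) })
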